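{- For any fixed $n\ge 1$, the sequences $$\ell_{2n,1}^{\mathrm{d2row}},\ \ell_{2n,2}^{\mathrm{d2row}},\dots,\ell_{2n,n}^{\mathrm{d2row}}\quad\text{and}\quad i_{2n,1}^{\mathrm{d2row}},\ i_{2n,2}^{\mathrm{d2row}},\dots,i_{2n,n}^{\mathrm{d2row}}$$ are log concave.
   Context: $\mathfrak S_{2n}$ is the set of permutations of $\{1,\dots,2n\}$. For $\pi\in\mathfrak S_{2n}$, $\ell(\pi)$ is the length of a longest increasing subsequence of $\pi$ (in one-line notation). The shape $\operatorname{sh}\pi$ is the common shape (a partition of $2n$) of the two standard Young tableaux associated with $\pi$ by the Robinson–Schensted correspondence. Let $\mathrm{d2row}$ be the set of partitions of $2n$ of the form $(k^2,(n-k)^2)=(k,k,n-k,n-k)$ with $n/2\le k\le n$ (for $k=n$ this is $(n,n)$). Then $\ell_{2n,k}^{\mathrm{d2row}}$ is the number of $\pi\in\mathfrak S_{2n}$ with $\ell(\pi)=k$ and $\operatorname{sh}\pi\in\mathrm{d2row}$, and $i_{2n,k}^{\mathrm{d2row}}$ is the number of involutions $\pi\in\mathfrak S_{2n}$ (permutations whose square is the identity) with $\ell(\pi)=k$ and $\operatorname{sh}\pi\in\mathrm{d2row}$. (These numbers are $0$ for $k<n/2$.) A sequence of real numbers $l_1,\dots,l_n$ is log concave if $l_{k-1}l_{k+1}\le l_k^2$ for all $1\le k\le n$, with the convention $l_0=l_{n+1}=0$. -}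

module Defs where

open import Data.Fin as Fin using (Fin)
import Data.Fin.Properties as Fin
open import Data.List as List using (List; []; _∷_; [_]; _++_; map; filter; length; foldr; foldl; allFin; cartesianProductWith)
import Data.List.Properties as List
open import Data.List.Relation.Unary.Linked using (Linked; linked?)
open import Data.Maybe using (Maybe; just; nothing)
open import Data.Nat
open import Data.Nat.Properties using (anyUpTo?; _≟_; _≤?_; _<?_)
open import Data.Product using (∃; _×_; _,_; proj₁)
open import Data.Vec as Vec using (Vec; []; _∷_; lookup; toList)
open import Data.Vec.Relation.Unary.Unique.Propositional using (Unique)
open import Data.Vec.Relation.Unary.AllPairs using (allPairs?)
open import Relation.Binary.PropositionalEquality using (_≡_)
open import Relation.Nullary using (Dec; yes; no)
open import Relation.Nullary.Decidable using (_×-dec_; ¬?)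

private variable
  A : Set
  m : ℕ

-- Permutations of an m-element set in one-line notation.  The letters are
-- 0, …, m-1 instead of 1, …, m; a word of length m over these m letters is
-- a permutation exactly when no letter is repeated.

Word : ℕ → Set
Word m = Vec (Fin m) m

words : (m l : ℕ) → List (Vec (Fin m) l)
words m zero    = [ [] ]
words m (suc l) = cartesianProductWith _∷_ (allFin m) (words m l)

unique? : (π : Word m) → Dec (Unique π)
unique? = allPairs? (λ i j → ¬? (i Fin.≟ j))

𝔖 : (m : ℕ) → List (Word m)
𝔖 m = filter unique? (words m m)

Involution : Word m → Set
Involution π = ∀ i → lookup π (lookup π i) ≡ i

involution? : (π : Word m) → Dec (Involution π)
involution? π = Fin.all? (λ i → lookup π (lookup π i) Fin.≟ i)

subsequences : List A → List (List A)
subsequences []       = [ [] ]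
subsequences (x ∷ xs) = map (x ∷_) (subsequences xs) ++ subsequences xs

Increasing : List (Fin m) → Set
Increasing = Linked Fin._<_

increasing? : (xs : List (Fin m)) → Dec (Increasing xs)
increasing? = linked? Fin._<?_

ℓ : Word m → ℕ
ℓ π = foldr _⊔_ 0 (map length (filter increasing? (subsequences (toList π))))

-- A tableau is the list of its rows, top row first, each read from left to
-- right.

Tableau : ℕ → Set
Tableau m = List (List (Fin m))

shape : Tableau m → List ℕ
shape = map length

-- Row insertion: x replaces the leftmost entry greater than x, and the
-- replaced entry is returned; if there is none, x is put at the end.

insertRow : Fin m → List (Fin m) → List (Fin m) × Maybe (Fin m)
insertRow x []      = [ x ] , nothing
insertRow x (y ∷ r) with x Fin.<? y
... | yes _ = x ∷ r , just y
... | no  _ = let r′ , b = insertRow x r in y ∷ r′ , b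

-- The second component is the index of the row that became longer.

insert : Fin m → Tableau m → Tableau m × ℕ
insert x []      = [ [ x ] ] , 0
insert x (r ∷ T) with insertRow x r
... | r′ , nothing = r′ ∷ T , 0
... | r′ , just y  = let T′ , i = insert y T in r′ ∷ T′ , suc i

addToRow : ℕ → Fin m → Tableau m → Tableau m
addToRow _       t []      = [ [ t ] ]
addToRow zero    t (r ∷ T) = (r ++ [ t ]) ∷ T
addToRow (suc i) t (r ∷ T) = r ∷ addToRow i t T

-- The insertion tableau and the recording tableau; the latter gets the
-- label t in the box created by inserting the t-th letter.

robinsonSchensted : Word m → Tableau m × Tableau m
robinsonSchensted {m} π = foldl step ([] , []) (List.zip (allFin m) (toList π))
  where
  step : Tableau m × Tableau m → Fin m × Fin m → Tableau m × Tableau m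
  step (P , Q) (t , x) = let P′ , i = insert x P in P′ , addToRow i t Q

-- The two tableaux have the same shape, since each step adds a box at the
-- end of the same row of both.

sh : Word m → List ℕ
sh π = shape (proj₁ (robinsonSchensted π))

-- A partition is the list of its nonzero parts, so the parts n ∸ k are
-- dropped when k = n.

twoDoubleRows : ℕ → ℕ → List ℕ
twoDoubleRows n k = filter (0 <?_) (k ∷ k ∷ n ∸ k ∷ n ∸ k ∷ [])

D2Row : ℕ → List ℕ → Set
D2Row n μ = ∃ λ k → k < suc n × n ≤ 2 * k × μ ≡ twoDoubleRows n k

d2row? : (n : ℕ) (μ : List ℕ) → Dec (D2Row n μ)
d2row? n μ = anyUpTo? (λ k → n ≤? 2 * k ×-dec List.≡-dec _≟_ μ (twoDoubleRows n k)) (suc n)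

ℓ-d2row : ℕ → ℕ → ℕ
ℓ-d2row n k = length (filter (λ π → ℓ π ≟ k ×-dec d2row? n (sh π)) (𝔖 (2 * n)))

i-d2row : ℕ → ℕ → ℕ
i-d2row n k = length (filter (λ π → involution? π ×-dec ℓ π ≟ k ×-dec d2row? n (sh π)) (𝔖 (2 * n)))

-- Only the values l 1, …, l n belong to the sequence; padded n l extends
-- it by 0 on both sides.

padded : ℕ → (ℕ → ℕ) → ℕ → ℕ
padded n l zero    = 0
padded n l (suc j) with j <? n
... | yes _ = l (suc j)
... | no  _ = 0

LogConcave : ℕ → (ℕ → ℕ) → Set
LogConcave n l = ∀ k → 1 ≤ k → k ≤ n →
  padded n l (k ∸ 1) * padded n l (suc k) ≤ padded n l k ^ 2

{-# OPTIONS --safe #-}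

-- Fomin's growth diagrams turn the Robinson–Schensted correspondence into a local rule on unit cells that can be run
-- in both directions and is symmetric under transposition.  Hence permutations of shape λ correspond to pairs of lattice
-- words of content λ, involutions to pairs of equal words, and, with Schensted's theorem ℓ(π) = λ₁, the two sequences
-- are f² and f for f the number of standard Young tableaux of shape (k, k, n - k, n - k).  The Frobenius formula
-- expresses f as (2n)! g(2k - n) over a product of factorials, where g(t) = (t + 1) (t + 2)² (t + 3) is log concave and
-- the factorials are log convex.

module Submission where

open import Defs
open import Data.Bool using (Bool; true; false; T)
open import Data.Fin as Fin using (Fin; zero; suc; toℕ; fromℕ<; punchOut)
import Data.Fin.Properties as Fin
open import Data.Fin.Properties using (toℕ-injective; toℕ-fromℕ<; toℕ<n; punchOut-injective; injective⇒≤; any?)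
open import Data.List as List using (List; []; _∷_; [_]; _++_; length; map; filter; foldl; zip; allFin; cartesianProduct)
open import Data.List.Membership.Propositional using (_∈_; lose)
open import Data.List.Membership.Propositional.Properties
open import Data.List.Properties using (length-++; length-map; length-tabulate; foldr-preservesᵇ; foldr-preservesᵒ)
open import Data.List.Relation.Unary.All as All using (All; []; _∷_)
import Data.List.Relation.Unary.All.Properties as All
open import Data.List.Relation.Unary.AllPairs using (AllPairs; []; _∷_)
open import Data.List.Relation.Unary.Any as Any using (here)
import Data.List.Relation.Unary.Any.Properties as Any
open import Data.List.Relation.Unary.Linked using ([]; [-]; _∷_)
import Data.List.Relation.Unary.Unique.Propositional as List
import Data.List.Relation.Unary.Unique.Propositional.Properties as ListUnique
open import Data.Maybe using (Maybe; just; nothing; fromMaybe)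
open import Data.Nat
open import Data.Nat.Properties
open import Data.Nat.Solver using (module +-*-Solver)
open import Data.Product using (∃-syntax; _×_; _,_; proj₁; proj₂)
open import Data.Product.Properties using (,-injective)
open import Data.Sum as Sum using (_⊎_; inj₁; inj₂)
open import Data.Vec as Vec using (Vec; []; _∷_; head; lookup; tabulate; toList)
open import Data.Vec.Properties using (lookup∘tabulate; tabulate∘lookup; tabulate-cong; length-toList; ∷-injective; ∷-injectiveʳ)
import Data.Vec.Relation.Unary.All.Properties as VecAll
import Data.Vec.Relation.Unary.AllPairs as VecAllPairs
open import Data.Vec.Relation.Unary.Unique.Propositional using (Unique)
open import Data.Vec.Relation.Unary.Unique.Propositional.Properties using (lookup-injective; tabulate⁺)
open import Function using (flip)
open import Relation.Binary.Definitions using (tri<; tri≈; tri>)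
open import Relation.Binary.PropositionalEquality hiding ([_])
open import Relation.Nullary using (yes; no; ¬_)
open import Relation.Nullary.Decidable using (_×-dec_; dec-true)
open import Relation.Nullary.Negation using (contradiction)
open import Relation.Unary using (Decidable)
open +-*-Solver using (solve; _:+_; _:*_; _:=_; con)

-- Because the local rule speaks of edge labels only, injectivity needs no shapes: the outgoing
-- edges of a cell determine its incoming edges and its cross. Shapes enter for surjectivity.
-- Backward filling never gets stuck, but its left and bottom boundaries must come out empty; this
-- follows by tracking shapes, which stay partitions and shrink to the empty one. Insertion of a
-- letter is matched with a row of cells by restricting tableaux to the values below `j` and letting
-- `j` grow: the newest value is then the largest, so it sits at the end of its row. The recording
-- tableau is not analysed; the right edges of the diagram play its part. The first column hooks of
-- (k, k, n - k, n - k) are k + 3, k + 2, n - k + 1, n - k. With t = 2k - n their differences are 1,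
-- 1, t + 1, t + 2, t + 2, t + 3, whose product is g(t). Passing from k to k + 1 raises t by 2, so
-- log concavity of g is needed with step 2.

private variable
  χ χ′ : Bool
  m l r s : ℕ
  A B : Set

-- Growth diagrams

Edge : Set
Edge = Maybe ℕ

private variable
  a a′ b b′ c c′ d d′ : Edge

-- Fomin's local rule for a cell of a growth diagram: χ marks a cross in the cell, a and b are its bottom and left
-- edges, c and d its top and right ones.  An edge records the row of the box added along it.  Written this way the rule
-- does not mention the shapes.

data Local : Bool → (a b c d : Edge) → Set where
  blank : Local false nothing nothing nothing nothing
  cross : Local true nothing nothing (just 0) (just 0)
  below : Local false (just r) nothing (just r) nothing
  aside : Local false nothing (just s) nothing (just s)
  apart : r ≢ s → Local false (just r) (just s) (just r) (just s)
  bump  : Local false (just r) (just r) (just (suc r)) (just (suc r))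

Local-transpose : Local χ a b c d → Local χ b a d c
Local-transpose blank       = blank
Local-transpose cross       = cross
Local-transpose below       = aside
Local-transpose aside       = below
Local-transpose (apart r≢s) = apart (≢-sym r≢s)
Local-transpose bump        = bump

Local-forward : Local χ a b c d → Local χ a b c′ d′ → c ≡ c′ × d ≡ d′
Local-forward blank       blank       = refl , refl
Local-forward cross       cross       = refl , refl
Local-forward below       below       = refl , refl
Local-forward aside       aside       = refl , refl
Local-forward (apart _)   (apart _)   = refl , refl
Local-forward (apart r≢r) bump        = contradiction refl r≢r
Local-forward bump        (apart r≢r) = contradiction refl r≢r
Local-forward bump        bump        = refl , refl

-- Two equal outgoing labels come from a cross if they are 0 and from a bump otherwise, while
-- `apart` keeps its labels distinct.
Local-backward : Local χ a b c d → Local χ′ a′ b′ c d → χ ≡ χ′ × a ≡ a′ × b ≡ b′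
Local-backward blank       blank       = refl , refl , refl
Local-backward cross       cross       = refl , refl , refl
Local-backward cross       (apart r≢r) = contradiction refl r≢r
Local-backward below       below       = refl , refl , refl
Local-backward aside       aside       = refl , refl , refl
Local-backward (apart r≢r) cross       = contradiction refl r≢r
Local-backward (apart _)   (apart _)   = refl , refl , refl
Local-backward (apart r≢r) bump        = contradiction refl r≢r
Local-backward bump        (apart r≢r) = contradiction refl r≢r
Local-backward bump        bump        = refl , refl , refl

-- Row i belongs to the i-th letter of a word and column j to the value j.  H i j is the bottom edge of the cell and V i j
-- its left edge; they are the row of j in the tableau after i letters, and the row reached when the insertion of the
-- i-th letter has dealt with all values below j.

Diagram : ℕ → (X : ℕ → ℕ → Bool) (H V : ℕ → ℕ → Edge) → Set
Diagram m X H V =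
  (∀ {i j} → i < m → j < m → Local (X i j) (H i j) (V i j) (H (suc i) j) (V i (suc j))) ×
  (∀ {j} → j < m → H 0 j ≡ nothing) × (∀ {i} → i < m → V i 0 ≡ nothing)

Diagram-transpose : ∀ {m X H V} → Diagram m X H V → Diagram m (flip X) (flip V) (flip H)
Diagram-transpose (loc , h₀ , v₀) = (λ i<m j<m → Local-transpose (loc j<m i<m)) , v₀ , h₀

Diagram-forward : ∀ {m X X′ H H′ V V′} → (∀ {i j} → i < m → j < m → X i j ≡ X′ i j) →
  Diagram m X H V → Diagram m X′ H′ V′ →
  (∀ {i j} → i ≤ m → j < m → H i j ≡ H′ i j) × (∀ {i j} → i < m → j ≤ m → V i j ≡ V′ i j)
Diagram-forward {m} {X} {X′} {H} {H′} {V} {V′} X≡ (loc , h₀ , v₀) (loc′ , h₀′ , v₀′) = h , v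
  where
  cell : ∀ i j → i < m → j < m → H i j ≡ H′ i j → V i j ≡ V′ i j →
         H (suc i) j ≡ H′ (suc i) j × V i (suc j) ≡ V′ i (suc j)
  cell i j i<m j<m eh ev = Local-forward (loc i<m j<m)
    (subst₂ (λ a b → Local _ a b _ _) (sym eh) (sym ev)
      (subst (λ x → Local x _ _ _ _) (sym (X≡ i<m j<m)) (loc′ i<m j<m)))
  h : ∀ {i j} → i ≤ m → j < m → H i j ≡ H′ i j
  v : ∀ {i j} → i < m → j ≤ m → V i j ≡ V′ i j
  h {zero}      _   j<m = trans (h₀ j<m) (sym (h₀′ j<m))
  h {suc i} {j} i<m j<m = proj₁ (cell i j i<m j<m (h (<⇒≤ i<m) j<m) (v i<m (<⇒≤ j<m)))
  v {i} {zero}  i<m _   = trans (v₀ i<m) (sym (v₀′ i<m))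
  v {i} {suc j} i<m j<m = proj₂ (cell i j i<m j<m (h (<⇒≤ i<m) j<m) (v i<m (<⇒≤ j<m)))

-- The induction starts at the top right corner; its decreasing arguments `p` and `q` are the
-- distances to the top and to the right border.
Diagram-backward : ∀ {m X X′ H H′ V V′} → Diagram m X H V → Diagram m X′ H′ V′ →
  (∀ {j} → j < m → H m j ≡ H′ m j) → (∀ {i} → i < m → V i m ≡ V′ i m) →
  ∀ {i j} → i < m → j < m → X i j ≡ X′ i j
Diagram-backward {m} {X} {X′} {H} {H′} {V} {V′} (loc , _) (loc′ , _) hₘ vₘ {i} {j} i<m j<m =
  proj₁ (cell i j e f (h (m ∸ suc i) (m ∸ suc j) (suc i) j e f) (v (m ∸ suc i) (m ∸ suc j) i (suc j) e f))
  where
  e = m∸n+n≡m i<m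
  f = m∸n+n≡m j<m
  small : ∀ p {i} → p + suc i ≡ m → i < m
  small p e = subst (_ <_) e (m≤n+m _ p)
  next : ∀ p {i} → suc p + i ≡ m → p + suc i ≡ m
  next p e = trans (+-suc p _) e
  cell : ∀ i j {p q} → p + suc i ≡ m → q + suc j ≡ m → H (suc i) j ≡ H′ (suc i) j → V i (suc j) ≡ V′ i (suc j) →
         X i j ≡ X′ i j × H i j ≡ H′ i j × V i j ≡ V′ i j
  cell i j {p} {q} e f eh ev = Local-backward (loc (small p e) (small q f))
    (subst₂ (λ c d → Local _ _ _ c d) (sym eh) (sym ev) (loc′ (small p e) (small q f)))
  h : ∀ p q i j → p + i ≡ m → q + suc j ≡ m → H i j ≡ H′ i j
  v : ∀ p q i j → p + suc i ≡ m → q + j ≡ m → V i j ≡ V′ i j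
  h zero    q i j refl f = hₘ (small q f)
  h (suc p) q i j e f = let e′ = next p e in
    proj₁ (proj₂ (cell i j e′ f (h p q (suc i) j e′ f) (v p q i (suc j) e′ f)))
  v p zero    i j e refl = vₘ (small p e)
  v p (suc q) i j e f = let f′ = next q f in
    proj₂ (proj₂ (cell i j e f′ (h p q (suc i) j e f′) (v p q i (suc j) e f′)))

-- Shapes

Shape : Set
Shape = ℕ → ℕ

IsPartition : Shape → Set
IsPartition μ = ∀ r → μ (suc r) ≤ μ r

box : ℕ → Shape
box zero    zero    = 1
box zero    (suc r) = 0
box (suc s) zero    = 0
box (suc s) (suc r) = box s r

box-self : ∀ r → box r r ≡ 1
box-self zero    = refl
box-self (suc r) = box-self r

box-≢ : s ≢ r → box s r ≡ 0
box-≢ {zero}  {zero}  s≢r = contradiction refl s≢r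
box-≢ {zero}  {suc r} s≢r = refl
box-≢ {suc s} {zero}  s≢r = refl
box-≢ {suc s} {suc r} s≢r = box-≢ (λ e → s≢r (cong suc e))

box-cases : ∀ s r → s ≡ r ⊎ box s r ≡ 0
box-cases s r with s ≟ r
... | yes s≡r = inj₁ s≡r
... | no  s≢r = inj₂ (box-≢ s≢r)

boxes : Edge → Shape
boxes nothing  r = 0
boxes (just s) r = box s r

content : (ℕ → Edge) → ℕ → Shape
content w zero    r = 0
content w (suc j) r = content w j r + boxes (w j) r

Local-boxes : Local χ a b c d → ∀ r → boxes a r + boxes d r ≡ boxes b r + boxes c r
Local-boxes blank           r = refl
Local-boxes cross           r = refl
Local-boxes below           r = +-comm _ 0
Local-boxes aside           r = +-comm 0 _
Local-boxes (apart {p} {q} _) r = +-comm (box p r) (box q r)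
Local-boxes bump            r = refl

-- Rows `r` and `suc r` can only get out of order if `d` adds a box to row `suc r`. Either that box
-- is also added by `b`, and the partition above the left edge covers it, or it was bumped out of
-- row `r`, which has then gained a box as well.
Local-partition : ∀ {μ : Shape} → Local χ a b c d → IsPartition μ →
  IsPartition (λ r → μ r + boxes a r) → IsPartition (λ r → μ r + boxes b r) →
  IsPartition (λ r → μ r + boxes a r + boxes d r)
Local-partition {a = a} {d = d} {μ = μ} rule π α β r = go rule α β
  where
  open ≤-Reasoning
  R = suc r
  no-d : ∀ a d → boxes d R ≡ 0 → IsPartition (λ r → μ r + boxes a r) →
         μ R + boxes a R + boxes d R ≤ μ r + boxes a r + boxes d r
  no-d a d z α = begin
    μ R + boxes a R + boxes d R ≡⟨ cong (μ R + boxes a R +_) z ⟩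
    μ R + boxes a R + 0         ≤⟨ +-mono-≤ (α r) z≤n ⟩
    μ r + boxes a r + boxes d r ∎
  go : ∀ {χ a b c d} → Local χ a b c d → IsPartition (λ r → μ r + boxes a r) → IsPartition (λ r → μ r + boxes b r) →
       μ R + boxes a R + boxes d R ≤ μ r + boxes a r + boxes d r
  go blank α β = no-d nothing nothing refl α
  go cross α β = no-d nothing (just 0) refl α
  go (below {p}) α β = no-d (just p) nothing refl α
  go (aside {q}) α β = subst₂ _≤_
    (cong (_+ box q R) (sym (+-identityʳ (μ R)))) (cong (_+ box q r) (sym (+-identityʳ (μ r)))) (β r)
  go (apart {p} {q} p≢q) α β with box-cases q R
  ... | inj₂ z = no-d (just p) (just q) z α
  ... | inj₁ refl = begin
    μ R + box p R + box R R ≡⟨ cong (λ e → μ R + e + box R R) (box-≢ p≢q) ⟩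
    μ R + 0 + box R R       ≡⟨ cong (_+ box R R) (+-identityʳ (μ R)) ⟩
    μ R + box R R           ≤⟨ β r ⟩
    μ r + box R r           ≤⟨ +-monoˡ-≤ (box R r) (m≤m+n (μ r) (box p r)) ⟩
    μ r + box p r + box R r ∎
  go (bump {p}) α β with box-cases p r
  ... | inj₂ z = no-d (just p) (just (suc p)) z α
  ... | inj₁ refl = begin
    μ R + box r R + box r r ≡⟨ cong (λ e → μ R + e + box r r) (box-≢ (<⇒≢ (n<1+n r))) ⟩
    μ R + 0 + box r r       ≡⟨ cong (_+ box r r) (+-identityʳ (μ R)) ⟩
    μ R + box r r           ≤⟨ +-monoˡ-≤ (box r r) (π r) ⟩
    μ r + box r r           ≤⟨ m≤m+n _ _ ⟩
    μ r + box r r + box R r ∎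

-- The point is that `α r ∸ boxes b r` never truncates. The critical case is `bump`: ν has a box in
-- row `suc r`, so its row `r`, which equals that of α, is nonempty. To order the rows of μ, compare
-- with whichever of α and β agrees with μ in row `r`; after a bump in that row neither does, and ν
-- settles it.
Local-partition-backward : ∀ {α β ν : Shape} → Local χ a b c d →
  IsPartition α → IsPartition β → IsPartition ν →
  (∀ r → α r + boxes c r ≡ ν r) → (∀ r → β r + boxes d r ≡ ν r) →
  let μ = λ r → α r ∸ boxes b r in
  IsPartition μ × (∀ r → μ r + boxes b r ≡ α r) × (∀ r → μ r + boxes a r ≡ β r)
Local-partition-backward {a = a} {b} {c} {d} {α} {β} {ν} rule πα πβ πν αc βd = (λ r → part rule r) , μb , μa
  where
  open ≤-Reasoning
  μ : Shape
  μ r = α r ∸ boxes b r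
  b≤α : ∀ {χ a b c d} → Local χ a b c d → (∀ r → α r + boxes c r ≡ ν r) → (∀ r → β r + boxes d r ≡ ν r) → ∀ r → boxes b r ≤ α r
  b≤α blank _ _ r = z≤n
  b≤α cross _ _ r = z≤n
  b≤α below _ _ r = z≤n
  b≤α (aside {q}) αc βd r = begin
    box q r       ≤⟨ m≤n+m _ (β r) ⟩
    β r + box q r ≡⟨ trans (βd r) (sym (αc r)) ⟩
    α r + 0       ≡⟨ +-identityʳ _ ⟩
    α r           ∎
  b≤α (apart {p} {q} p≢q) αc βd r with box-cases q r
  ... | inj₂ z = ≤-trans (≤-reflexive z) z≤n
  ... | inj₁ refl = begin
    box r r       ≤⟨ m≤n+m _ (β r) ⟩
    β r + box r r ≡⟨ trans (βd r) (sym (αc r)) ⟩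
    α r + box p r ≡⟨ cong (α r +_) (box-≢ p≢q) ⟩
    α r + 0       ≡⟨ +-identityʳ _ ⟩
    α r           ∎
  b≤α (bump {p}) αc βd r with box-cases p r
  ... | inj₂ z = ≤-trans (≤-reflexive z) z≤n
  ... | inj₁ refl = begin
    box r r                   ≤⟨ m≤n+m _ (α (suc r)) ⟩
    α (suc r) + box r r       ≡⟨ αc (suc r) ⟩
    ν (suc r)                 ≤⟨ πν r ⟩
    ν r                       ≡⟨ sym (αc r) ⟩
    α r + box (suc r) r       ≡⟨ cong (α r +_) (box-≢ (≢-sym (<⇒≢ (n<1+n r)))) ⟩
    α r + 0                   ≡⟨ +-identityʳ _ ⟩
    α r                       ∎
  μb : ∀ r → μ r + boxes b r ≡ α r
  μb r = m∸n+n≡m (b≤α rule αc βd r)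
  μa : ∀ r → μ r + boxes a r ≡ β r
  μa r = +-cancelʳ-≡ (boxes d r) _ _ (begin-equality
    μ r + boxes a r + boxes d r   ≡⟨ +-assoc (μ r) _ _ ⟩
    μ r + (boxes a r + boxes d r) ≡⟨ cong (μ r +_) (Local-boxes rule r) ⟩
    μ r + (boxes b r + boxes c r) ≡⟨ +-assoc (μ r) _ _ ⟨
    μ r + boxes b r + boxes c r   ≡⟨ cong (_+ boxes c r) (μb r) ⟩
    α r + boxes c r               ≡⟨ trans (αc r) (sym (βd r)) ⟩
    β r + boxes d r               ∎)
  no-b : ∀ r → boxes b r ≡ 0 → μ (suc r) ≤ μ r
  no-b r z = begin
    μ (suc r)                     ≤⟨ m≤m+n _ _ ⟩
    μ (suc r) + boxes b (suc r)   ≡⟨ μb (suc r) ⟩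
    α (suc r)                     ≤⟨ πα r ⟩
    α r                           ≡⟨ μb r ⟨
    μ r + boxes b r               ≡⟨ cong (μ r +_) z ⟩
    μ r + 0                       ≡⟨ +-identityʳ _ ⟩
    μ r                           ∎
  no-a : ∀ r → boxes a r ≡ 0 → μ (suc r) ≤ μ r
  no-a r z = begin
    μ (suc r)                     ≤⟨ m≤m+n _ _ ⟩
    μ (suc r) + boxes a (suc r)   ≡⟨ μa (suc r) ⟩
    β (suc r)                     ≤⟨ πβ r ⟩
    β r                           ≡⟨ μa r ⟨
    μ r + boxes a r               ≡⟨ cong (μ r +_) z ⟩
    μ r + 0                       ≡⟨ +-identityʳ _ ⟩
    μ r                           ∎
  bumped : ∀ r → b ≡ just r → c ≡ just (suc r) → μ (suc r) ≤ μ r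
  bumped r refl refl = +-cancelʳ-≤ 1 _ _ (begin
    μ (suc r) + 1                 ≡⟨ cong₂ _+_ (cong (α (suc r) ∸_) (box-≢ (<⇒≢ (n<1+n r)))) (sym (box-self r)) ⟩
    α (suc r) + box r r           ≡⟨ αc (suc r) ⟩
    ν (suc r)                     ≤⟨ πν r ⟩
    ν r                           ≡⟨ αc r ⟨
    α r + box (suc r) r           ≡⟨ cong (α r +_) (box-≢ (≢-sym (<⇒≢ (n<1+n r)))) ⟩
    α r + 0                       ≡⟨ +-identityʳ _ ⟩
    α r                           ≡⟨ μb r ⟨
    μ r + box r r                 ≡⟨ cong (μ r +_) (box-self r) ⟩
    μ r + 1                       ∎)
  part : Local χ a b c d → IsPartition μ
  part blank      r = no-b r refl
  part cross      r = no-b r refl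
  part below      r = no-b r refl
  part aside      r = no-a r refl
  part (apart {p} {q} p≢q) r with box-cases q r
  ... | inj₂ z    = no-b r z
  ... | inj₁ refl = no-a r (box-≢ p≢q)
  part (bump {p}) r with box-cases p r
  ... | inj₂ z    = no-b r z
  ... | inj₁ refl = bumped r refl refl

-- content (H i) j and content (flip V j) i both are the shape at the lower left corner of cell (i , j).

content-next-row : ∀ {m X H V i} → Diagram m X H V → i < m → ∀ j → j ≤ m → ∀ r →
  content (H i) j r + boxes (V i j) r ≡ content (H (suc i)) j r
content-next-row (_ , _ , v₀) i<m zero _ r = cong (λ e → boxes e r) (v₀ i<m)
content-next-row {H = H} {V} {i} D@(loc , _) i<m (suc j) j<m r = begin
  content (H i) j r + boxes (H i j) r + boxes (V i (suc j)) r   ≡⟨ +-assoc (content (H i) j r) _ _ ⟩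
  content (H i) j r + (boxes (H i j) r + boxes (V i (suc j)) r) ≡⟨ cong (content (H i) j r +_) (Local-boxes (loc i<m j<m) r) ⟩
  content (H i) j r + (boxes (V i j) r + boxes (H (suc i) j) r) ≡⟨ +-assoc (content (H i) j r) _ _ ⟨
  content (H i) j r + boxes (V i j) r + boxes (H (suc i) j) r   ≡⟨ cong (_+ boxes (H (suc i) j) r) (content-next-row D i<m j (<⇒≤ j<m) r) ⟩
  content (H (suc i)) j r + boxes (H (suc i) j) r ∎
  where open ≡-Reasoning

content-nothing : ∀ w j → (∀ {k} → k < j → w k ≡ nothing) → ∀ r → content w j r ≡ 0
content-nothing w zero    _ r = refl
content-nothing w (suc j) e r rewrite e (n<1+n j) = trans (+-identityʳ _) (content-nothing w j (λ k<j → e (m<n⇒m<1+n k<j)) r)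

content-transpose : ∀ {m X H V} → Diagram m X H V → ∀ i j → i ≤ m → j ≤ m → ∀ r →
  content (H i) j r ≡ content (flip V j) i r
content-transpose {H = H} (_ , h₀ , _) zero j _ j≤m r = content-nothing (H 0) j (λ k<j → h₀ (<-≤-trans k<j j≤m)) r
content-transpose {V = V} D (suc i) j i<m j≤m r = trans (sym (content-next-row D i<m j j≤m r))
  (cong (_+ boxes (V i j) r) (content-transpose D i j (<⇒≤ i<m) j≤m r))

IsPartition-resp : ∀ {μ ν : Shape} → (∀ r → μ r ≡ ν r) → IsPartition μ → IsPartition ν
IsPartition-resp e π r = subst₂ _≤_ (e (suc r)) (e r) (π r)

content-partition : ∀ {m X H V} → Diagram m X H V → ∀ i j → i ≤ m → j ≤ m → IsPartition (content (H i) j)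
content-partition {H = H} D@(_ , h₀ , _) zero j i≤m j≤m =
  IsPartition-resp (λ r → sym (content-nothing (H 0) j (λ k<j → h₀ (<-≤-trans k<j j≤m)) r)) (λ _ → z≤n)
content-partition D (suc i) zero i<m j≤m r = z≤n
content-partition D@(loc , _) (suc i) (suc j) i<m j<m = IsPartition-resp (content-next-row D i<m (suc j) j<m)
  (Local-partition (loc i<m j<m) (content-partition D i j i≤m j≤m) (content-partition D i (suc j) i≤m j<m)
    (IsPartition-resp (λ r → sym (content-next-row D i<m j j≤m r)) (content-partition D (suc i) j i<m j≤m)))
  where
  i≤m = <⇒≤ i<m
  j≤m = <⇒≤ j<m

-- Diagrams and permutations

-- On a cross the incoming edges are ignored; `step-Local` therefore asks that they be empty, which
-- holds when no row or column has two crosses.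
step : Bool → Edge → Edge → Edge × Edge
step true  _        _        = just 0 , just 0
step false (just r) (just s) with r ≟ s
... | yes _ = just (suc r) , just (suc r)
... | no  _ = just r , just s
step false (just r) nothing  = just r , nothing
step false nothing  b        = nothing , b

step-Local : ∀ χ a b → (χ ≡ true → a ≡ nothing × b ≡ nothing) → let c , d = step χ a b in Local χ a b c d
step-Local true  a b e with e refl
... | refl , refl = cross
step-Local false (just r) (just s) _ with r ≟ s
... | yes refl = bump
... | no  r≢s  = apart r≢s
step-Local false (just r) nothing  _ = below
step-Local false nothing  (just s) _ = aside
step-Local false nothing  nothing  _ = blank

-- Unlike `step`, this has no side condition: every pair of outgoing edges has a preimage.
unstep : ∀ c d → ∃[ χ ] ∃[ a ] ∃[ b ] Local χ a b c d
unstep nothing        nothing  = _ , _ , _ , blank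
unstep nothing        (just s) = _ , _ , _ , aside
unstep (just r)       nothing  = _ , _ , _ , below
unstep (just r)       (just s) with r ≟ s
unstep (just r)       (just s)  | no r≢s   = _ , _ , _ , apart r≢s
unstep (just zero)    (just .0) | yes refl = _ , _ , _ , cross
unstep (just (suc r)) (just _)  | yes refl = _ , _ , _ , bump

module Grow (X : ℕ → ℕ → Bool) where

  H V : ℕ → ℕ → Edge
  H zero    j = nothing
  H (suc i) j = proj₁ (step (X i j) (H i j) (V i j))
  V i zero    = nothing
  V i (suc j) = proj₂ (step (X i j) (H i j) (V i j))

  H-empty : ∀ i j → (∀ {k} → k < i → X k j ≢ true) → H i j ≡ nothing
  H-empty zero    j _ = refl
  H-empty (suc i) j e with X i j in eq | H-empty i j (λ k<i → e (m<n⇒m<1+n k<i))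
  ... | true  | _ = contradiction eq (e (n<1+n i))
  ... | false | h rewrite h = refl

  V-empty : ∀ i j → (∀ {k} → k < j → X i k ≢ true) → V i j ≡ nothing
  V-empty i zero    _ = refl
  V-empty i (suc j) e with X i j in eq | V-empty i j (λ k<j → e (m<n⇒m<1+n k<j))
  ... | true  | _ = contradiction eq (e (n<1+n j))
  ... | false | v rewrite v with H i j
  ...   | just _  = refl
  ...   | nothing = refl

  diagram : (∀ {i k j} → k < i → i < m → j < m → X k j ≡ true → X i j ≢ true) →
            (∀ {i k j} → k < j → j < m → i < m → X i k ≡ true → X i j ≢ true) → Diagram m X H V
  diagram col row = (λ {i} {j} i<m j<m → step-Local (X i j) (H i j) (V i j) λ e →
      H-empty i j (λ k<i e′ → col k<i i<m j<m e′ e) , V-empty i j (λ k<j e′ → row k<j j<m i<m e′ e))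
    , (λ _ → refl) , (λ _ → refl)

-- Positions and values are natural numbers, as in diagrams; the value 0 past the end is a mere
-- default.
at : Vec (Fin m) l → ℕ → ℕ
at []      _       = 0
at (y ∷ π) zero    = toℕ y
at (y ∷ π) (suc i) = at π i

at-lookup : (π : Vec (Fin m) l) (i : Fin l) → at π (toℕ i) ≡ toℕ (lookup π i)
at-lookup (y ∷ π) Fin.zero    = refl
at-lookup (y ∷ π) (Fin.suc i) = at-lookup π i

at-< : (π : Vec (Fin m) l) {i : ℕ} → i < l → at π i < m
at-< (y ∷ π) {zero}  _         = toℕ<n y
at-< (y ∷ π) {suc i} (s≤s i<m) = at-< π i<m

crosses : Vec (Fin m) l → ℕ → ℕ → Bool
crosses π i j = at π i ≡ᵇ j

crosses-true : (π : Vec (Fin m) l) → ∀ {i j} → crosses π i j ≡ true → at π i ≡ j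
crosses-true π e = ≡ᵇ⇒≡ _ _ (subst T (sym e) _)

crosses-at : (π : Vec (Fin m) l) → ∀ i → crosses π i (at π i) ≡ true
crosses-at π i = dec-true (at π i ≟ at π i) refl

at-injective : {π : Word m} → Unique π → ∀ {i k} → i < m → k < m → at π i ≡ at π k → i ≡ k
at-injective {π = π} u i<m k<m e = trans (sym (toℕ-fromℕ< i<m)) (trans (cong toℕ
  (lookup-injective u (fromℕ< i<m) (fromℕ< k<m) (toℕ-injective (begin
    toℕ (lookup π (fromℕ< i<m)) ≡⟨ at-lookup π (fromℕ< i<m) ⟨
    at π (toℕ (fromℕ< i<m))     ≡⟨ cong (at π) (toℕ-fromℕ< i<m) ⟩
    at π _                      ≡⟨ e ⟩
    at π _                      ≡⟨ cong (at π) (toℕ-fromℕ< k<m) ⟨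
    at π (toℕ (fromℕ< k<m))     ≡⟨ at-lookup π (fromℕ< k<m) ⟩
    toℕ (lookup π (fromℕ< k<m)) ∎)))) (toℕ-fromℕ< k<m))
  where open ≡-Reasoning

permutation-diagram : {π : Word m} → Unique π → Diagram m (crosses π) (Grow.H (crosses π)) (Grow.V (crosses π))
permutation-diagram {π = π} u = Grow.diagram (crosses π)
  (λ k<i i<m j<m e e′ → <⇒≢ k<i (at-injective u (<-trans k<i i<m) i<m (trans (crosses-true π e) (sym (crosses-true π e′)))))
  (λ k<j _ _ e e′ → <⇒≢ k<j (trans (sym (crosses-true π e)) (crosses-true π e′)))

Just : Edge → Set
Just e = ∃[ r ] e ≡ just r

Local-cross⁺ : Local χ a b c d → b ≡ nothing → Just d → χ ≡ true
Local-cross⁺ cross refl _ = refl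

Local-Just : Local χ a b c d → Just b → Just d
Local-Just aside     j = j
Local-Just (apart _) j = j
Local-Just bump      j = _ , refl

Local-true : Local χ a b c d → χ ≡ true → b ≡ nothing × Just d
Local-true cross refl = refl , _ , refl

module _ {m X H V} (D : Diagram m X H V) {i : ℕ} (i<m : i < m) where

  private
    loc : ∀ {j} → j < m → _
    loc = proj₁ D i<m

  -- Along a row the vertical edges start at `nothing`, only a cross makes them `just`, and they
  -- stay so; hence a nonempty edge has a cross to its left.
  find-cross : ∀ j → j ≤ m → Just (V i j) → ∃[ k ] k < j × X i k ≡ true
  find-cross zero    _   (_ , e) with () ← trans (sym e) (proj₂ (proj₂ D) i<m)
  find-cross (suc j) j<m J with V i j in eq
  ... | nothing = j , n<1+n j , Local-cross⁺ (loc j<m) eq J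
  ... | just r  with find-cross j (<⇒≤ j<m) (r , eq)
  ...   | k , k<j , e = k , m<n⇒m<1+n k<j , e

  cross-Just : ∀ {k} j → k < j → j ≤ m → X i k ≡ true → Just (V i j)
  cross-Just {k} (suc j) (s≤s k≤j) j<m e with k ≟ j
  ... | yes refl = proj₂ (Local-true (loc j<m) e)
  ... | no  k≢j  = Local-Just (loc j<m) (cross-Just j (≤∧≢⇒< k≤j k≢j) (<⇒≤ j<m) e)

  -- After the first cross the edge is nonempty, but a second cross would need an empty left edge.
  cross-< : ∀ {k j} → k < j → j < m → X i k ≡ true → X i j ≢ true
  cross-< k<j j<m e e′ with cross-Just _ k<j (<⇒≤ j<m) e | Local-true (loc j<m) e′
  ... | _ , p | q , _ with () ← trans (sym p) q

  cross-unique : ∀ {k j} → k < m → j < m → X i k ≡ true → X i j ≡ true → k ≡ j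
  cross-unique {k} {j} k<m j<m e e′ with <-cmp k j
  ... | tri< k<j _ _ = contradiction e′ (cross-< k<j j<m e)
  ... | tri≈ _ k≡j _ = k≡j
  ... | tri> _ _ j<k = contradiction e (cross-< j<k k<m e′)

-- The nonempty right edge yields a cross in each row. Uniqueness of crosses in the transposed
-- diagram makes the resulting map injective.
diagram-permutation : ∀ {X H V} → Diagram m X H V → (∀ {i} → i < m → Just (V i m)) →
  ∃[ π ] Unique {A = Fin m} {n = m} π × (∀ {i j} → i < m → j < m → X i j ≡ crosses π i j)
diagram-permutation {m} {X} D J = π , tabulate⁺ injective , X≡
  where
  f : ∀ {i} → i < m → ∃[ k ] k < m × X i k ≡ true
  f i<m = find-cross D i<m m ≤-refl (J i<m)
  g : Fin m → Fin m
  g i = fromℕ< (proj₁ (proj₂ (f (toℕ<n i))))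
  g-cross : ∀ i → X (toℕ i) (toℕ (g i)) ≡ true
  g-cross i = trans (cong (X (toℕ i)) (toℕ-fromℕ< _)) (proj₂ (proj₂ (f (toℕ<n i))))
  injective : ∀ {i j} → g i ≡ g j → i ≡ j
  injective {i} {j} e = toℕ-injective (cross-unique (Diagram-transpose D) (toℕ<n (g i)) (toℕ<n i) (toℕ<n j)
    (g-cross i) (trans (cong (λ y → X (toℕ j) (toℕ y)) e) (g-cross j)))
  π : Word m
  π = tabulate g
  at-π : ∀ {i} (i<m : i < m) → at π i ≡ toℕ (g (fromℕ< i<m))
  at-π {i} i<m = trans (cong (at π) (sym (toℕ-fromℕ< i<m)))
    (trans (at-lookup π (fromℕ< i<m)) (cong toℕ (lookup∘tabulate g (fromℕ< i<m))))
  π-cross : ∀ {i} → i < m → X i (at π i) ≡ true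
  π-cross {i} i<m = subst₂ (λ i k → X i k ≡ true) (toℕ-fromℕ< i<m) (sym (at-π i<m)) (g-cross (fromℕ< i<m))
  X≡ : ∀ {i j} → i < m → j < m → X i j ≡ crosses π i j
  X≡ {i} {j} i<m j<m with X i j in eq | crosses π i j in eq′
  ... | true  | true  = refl
  ... | false | false = refl
  ... | true  | false = trans (sym (crosses-at π i)) (trans (cong (crosses π i)
    (cross-unique D i<m (subst (_< m) (sym (at-π i<m)) (toℕ<n _)) j<m (π-cross i<m) eq)) eq′)
  ... | false | true  = trans (sym eq) (trans (cong (X i) (sym (crosses-true π eq′))) (π-cross i<m))

at-ext : (π ρ : Word m) → (∀ {i} → i < m → at π i ≡ at ρ i) → π ≡ ρ
at-ext π ρ e = trans (sym (tabulate∘lookup π)) (trans (tabulate-cong λ i → toℕ-injective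
  (trans (sym (at-lookup π i)) (trans (e (toℕ<n i)) (at-lookup ρ i)))) (tabulate∘lookup ρ))

injective⇒surjective : (f : Fin m → Fin m) → (∀ {i j} → f i ≡ f j → i ≡ j) → ∀ k → ∃[ i ] f i ≡ k
injective⇒surjective {suc m} f inj k with any? (λ i → f i Fin.≟ k)
... | yes hit  = hit
... | no  miss = contradiction (injective⇒≤ {f = λ i → punchOut (avoid i)}
                   (λ {i} {j} e → inj (punchOut-injective (avoid i) (avoid j) e))) 1+n≰n
  where
  avoid : ∀ i → k ≢ f i
  avoid i k≡fi = miss (i , sym k≡fi)

at-surjective : {π : Word m} → Unique π → ∀ {j} → j < m → ∃[ i ] i < m × at π i ≡ j
at-surjective {π = π} u {j} j<m with injective⇒surjective (lookup π) (λ {i} {k} → lookup-injective u i k) (fromℕ< j<m)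
... | i , e = toℕ i , toℕ<n i , trans (at-lookup π i) (trans (cong toℕ e) (toℕ-fromℕ< j<m))

-- Lattice (Yamanouchi) words: `w j` is the row of entry `j` in a standard Young tableau, and the
-- prefix contents are the shapes of its initial parts. `Just` demands that no entry be missing.
IsLattice : ℕ → (ℕ → Edge) → Set
IsLattice m w = (∀ {j} → j ≤ m → IsPartition (content w j)) × (∀ {j} → j < m → Just (w j))

module _ {π : Word m} (uniq : Unique π) {H V} (D : Diagram m (crosses π) H V) where

  right-Just : ∀ {i} → i < m → Just (V i m)
  right-Just {i} i<m = cross-Just D i<m m (at-< π i<m) ≤-refl (crosses-at π i)

  top-Just : ∀ {j} → j < m → Just (H m j)
  top-Just j<m with at-surjective uniq j<m
  ... | i , i<m , refl = cross-Just (Diagram-transpose D) (at-< π i<m) m i<m ≤-refl (crosses-at π i)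

  top-lattice : IsLattice m (H m)
  top-lattice = content-partition D m _ ≤-refl , top-Just

  right-lattice : IsLattice m (flip V m)
  right-lattice = content-partition (Diagram-transpose D) m _ ≤-refl , right-Just

-- Filling a diagram backward from two lattice words

module _ {u v : ℕ → Edge} (u-lattice : IsLattice m u) (v-lattice : IsLattice m v)
         (same-shape : ∀ r → content u m r ≡ content v m r) where

  private
    -- The diagram is filled in backward from its top right corner: p and q count rows from the top and columns from
    -- the right, and Λ p q is the shape at the upper right corner of cell (p , q).
    H′ V′ : ℕ → ℕ → Edge
    H′ zero    q = u (m ∸ suc q)
    H′ (suc p) q = proj₁ (proj₂ (unstep (H′ p q) (V′ p q)))
    V′ p zero    = v (m ∸ suc p)
    V′ p (suc q) = proj₁ (proj₂ (proj₂ (unstep (H′ p q) (V′ p q))))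

    X′ : ℕ → ℕ → Bool
    X′ p q = proj₁ (unstep (H′ p q) (V′ p q))

    rule : ∀ p q → Local (X′ p q) (H′ (suc p) q) (V′ p (suc q)) (H′ p q) (V′ p q)
    rule p q = proj₂ (proj₂ (proj₂ (unstep (H′ p q) (V′ p q))))

    Λ : ℕ → ℕ → Shape
    Λ p       zero    r = content v (m ∸ p) r
    Λ zero    (suc q) r = content u (m ∸ suc q) r
    Λ (suc p) (suc q) r = Λ p (suc q) r ∸ boxes (V′ p (suc q)) r

    content-suc : ∀ (w : ℕ → Edge) {i} → i < m → ∀ r →
      content w (m ∸ suc i) r + boxes (w (m ∸ suc i)) r ≡ content w (m ∸ i) r
    content-suc w i<m r = cong (λ k → content w k r) (sym (+-∸-assoc 1 i<m))

    -- The invariant along the horizontal line at depth `p`; `Column` is the step from it down to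
    -- depth `suc p` at position `q`. Sweeping leftwards from the right border, whose shapes are
    -- known from `v`, turns `Row p` into `Row (suc p)`.
    Row : ℕ → Set
    Row p = (∀ q → q ≤ m → IsPartition (Λ p q)) ×
            (∀ q → q < m → ∀ r → Λ p (suc q) r + boxes (H′ p q) r ≡ Λ p q r)

    Column : ℕ → ℕ → Set
    Column p q = IsPartition (Λ (suc p) q) × (∀ r → Λ (suc p) q r + boxes (V′ p q) r ≡ Λ p q r)

    corner : ∀ {p} q → q < m → Row p → Column p q →
      Column p (suc q) × (∀ r → Λ (suc p) (suc q) r + boxes (H′ (suc p) q) r ≡ Λ (suc p) q r)
    corner {p} q q<m (parts , h) (πβ , v)
      with Local-partition-backward (rule p q) (parts (suc q) q<m) πβ (parts q (<⇒≤ q<m)) (h q q<m) v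
    ... | πμ , μb , μa = (πμ , μb) , μa

    column : ∀ p q → p < m → q ≤ m → Row p → Column p q
    column p zero    p<m _   _   = proj₁ v-lattice (m∸n≤m m (suc p)) , content-suc v p<m
    column p (suc q) p<m q<m row = proj₁ (corner q q<m row (column p q p<m (<⇒≤ q<m) row))

    row : ∀ p → p ≤ m → Row p
    row zero _ = part , h
      where
      part : ∀ q → q ≤ m → IsPartition (Λ 0 q)
      part zero    _   = proj₁ v-lattice ≤-refl
      part (suc q) q<m = proj₁ u-lattice (m∸n≤m m (suc q))
      h : ∀ q → q < m → ∀ r → content u (m ∸ suc q) r + boxes (u (m ∸ suc q)) r ≡ Λ 0 q r
      -- The two words meet at the top right corner, where their contents have to agree.
      h zero    0<m r = trans (content-suc u 0<m r) (same-shape r)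
      h (suc q) q<m r = content-suc u q<m r
    row (suc p) p<m = (λ q q≤m → proj₁ (col q q≤m)) , (λ q q<m → proj₂ (corner q q<m below-row (col q (<⇒≤ q<m))))
      where
      below-row = row p (<⇒≤ p<m)
      col : ∀ q → q ≤ m → Column p q
      col q q≤m = column p q p<m q≤m below-row

    no-boxes : ∀ e → (∀ r → boxes e r ≤ 0) → e ≡ nothing
    no-boxes nothing  _ = refl
    no-boxes (just r) z with () ← ≤-trans (≤-reflexive (sym (box-self r))) (z r)

    -- A walk leftwards along the bottom boundary from its right end, where no letter of `v` is
    -- left; shapes only shrink. `bottom-empty` walks down the left boundary in the same way. Edges
    -- between empty shapes are `nothing` by `no-boxes`.
    left-empty : ∀ q → q ≤ m → ∀ r → Λ m q r ≤ 0
    left-empty zero    _   r = ≤-reflexive (cong (λ k → content v k r) (n∸n≡0 m))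
    left-empty (suc q) q<m r = ≤-trans (m≤m+n _ _) (≤-trans (≤-reflexive (proj₂ (row m ≤-refl) q q<m r)) (left-empty q (<⇒≤ q<m) r))

    bottom-empty : ∀ p → p ≤ m → ∀ r → Λ p m r ≤ 0
    bottom-empty zero    _   r = lemma m refl
      where
      lemma : ∀ k → k ≡ m → Λ 0 k r ≤ 0
      lemma zero    refl = z≤n
      lemma (suc k) refl = ≤-reflexive (cong (λ k → content u k r) (n∸n≡0 m))
    bottom-empty (suc p) p<m r = ≤-trans (m≤m+n _ _)
      (≤-trans (≤-reflexive (proj₂ (column p m p<m ≤-refl (row p (<⇒≤ p<m))) r)) (bottom-empty p (<⇒≤ p<m) r))

    from-top : ∀ {i} → i < m → m ∸ suc (m ∸ suc i) ≡ i
    from-top {i} i<m = trans (cong (m ∸_) (sym (+-∸-assoc 1 i<m))) (m∸[m∸n]≡n (<⇒≤ i<m))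

  lattice-diagram : ∃[ X ] ∃[ H ] ∃[ V ] Diagram m X H V ×
    (∀ {j} → j < m → H m j ≡ u j) × (∀ {i} → i < m → V i m ≡ v i)
  lattice-diagram = (λ i j → X′ (m ∸ suc i) (m ∸ suc j)) , (λ i j → H′ (m ∸ i) (m ∸ suc j)) ,
    (λ i j → V′ (m ∸ suc i) (m ∸ j))
    , (loc , (λ {j} j<m → no-boxes (H′ m (m ∸ suc j)) λ r → ≤-trans (m≤n+m _ (Λ m (suc (m ∸ suc j)) r)) (≤-trans
               (≤-reflexive (proj₂ (row m ≤-refl) (m ∸ suc j) (∸-< j<m) r)) (left-empty (m ∸ suc j) (<⇒≤ (∸-< j<m)) r)))
           , (λ {i} i<m → no-boxes (V′ (m ∸ suc i) m) λ r → ≤-trans (m≤n+m _ (Λ (suc (m ∸ suc i)) m r)) (≤-trans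
               (≤-reflexive (proj₂ (column (m ∸ suc i) m (∸-< i<m) ≤-refl (row (m ∸ suc i) (<⇒≤ (∸-< i<m)))) r))
               (bottom-empty (m ∸ suc i) (<⇒≤ (∸-< i<m)) r))))
    , (λ {j} j<m → trans (cong (λ k → H′ k (m ∸ suc j)) (n∸n≡0 m)) (cong u (from-top j<m)))
    , (λ {i} i<m → trans (cong (V′ (m ∸ suc i)) (n∸n≡0 m)) (cong v (from-top i<m)))
    where
    ∸-< : ∀ {i} → i < m → m ∸ suc i < m
    ∸-< i<m = ∸-monoʳ-< (s≤s z≤n) i<m
    loc : ∀ {i j} → i < m → j < m → Local (X′ (m ∸ suc i) (m ∸ suc j)) (H′ (m ∸ i) (m ∸ suc j)) (V′ (m ∸ suc i) (m ∸ j))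
            (H′ (m ∸ suc i) (m ∸ suc j)) (V′ (m ∸ suc i) (m ∸ suc j))
    loc {i} {j} i<m j<m = subst₂ (λ a b → Local (X′ p q) a b (H′ p q) (V′ p q))
      (cong (λ k → H′ k q) (sym (+-∸-assoc 1 i<m))) (cong (V′ p) (sym (+-∸-assoc 1 j<m))) (rule p q)
      where
      p = m ∸ suc i
      q = m ∸ suc j

-- Any diagram on the crosses of π will do, since it coincides with the one filled backward by
-- `Diagram-forward`.
lattice-permutation : ∀ {u v} → IsLattice m u → IsLattice m v → (∀ r → content u m r ≡ content v m r) →
  ∃[ π ] Unique {A = Fin m} {n = m} π × (∀ {H V} → Diagram m (crosses π) H V →
    (∀ {j} → j < m → H m j ≡ u j) × (∀ {i} → i < m → V i m ≡ v i))
lattice-permutation Lu Lv same with lattice-diagram Lu Lv same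
... | X , H , V , D , top , right
  with diagram-permutation D (λ i<m → let r , e = proj₂ Lv i<m in r , trans (right i<m) e)
...   | π , uniq , X≡ = π , uniq , λ D′ → let h , v = Diagram-forward X≡ D D′ in
        (λ j<m → trans (sym (h ≤-refl j<m)) (top j<m)) , (λ i<m → trans (sym (v i<m ≤-refl)) (right i<m))

-- Insertion tableaux

module _ {m : ℕ} where

  private variable
    x y t : Fin m
    ρ ρ′ : List (Fin m)
    P Q : Tableau m

  Below : Fin m → Tableau m → Set
  Below t = All (All (Fin._< t))

  insertRow-nothing-∷ʳ : x Fin.< t → insertRow x ρ ≡ (ρ′ , nothing) → insertRow x (ρ ++ [ t ]) ≡ (ρ′ , just t)
  insertRow-nothing-∷ʳ {x} {t} {[]} x<t refl with x Fin.<? t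
  ... | yes _  = refl
  ... | no x≮t = contradiction x<t x≮t
  insertRow-nothing-∷ʳ {x} {t} {y ∷ ρ} x<t e with x Fin.<? y
  ... | no _ with insertRow x ρ in eq
  insertRow-nothing-∷ʳ {x} {t} {y ∷ ρ} x<t refl | no _ | ρ″ , nothing rewrite insertRow-nothing-∷ʳ {ρ = ρ} x<t eq = refl

  insertRow-just-∷ʳ : ∀ t → insertRow x ρ ≡ (ρ′ , just y) → insertRow x (ρ ++ [ t ]) ≡ (ρ′ ++ [ t ] , just y)
  insertRow-just-∷ʳ {x} {z ∷ ρ} t e with x Fin.<? z
  insertRow-just-∷ʳ {x} {z ∷ ρ} t refl | yes _ = refl
  ... | no _ with insertRow x ρ in eq
  insertRow-just-∷ʳ {x} {z ∷ ρ} t refl | no _ | ρ″ , just _ rewrite insertRow-just-∷ʳ {ρ = ρ} t eq = refl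

  insertRow-max : All (Fin._< t) ρ → insertRow t ρ ≡ (ρ ++ [ t ] , nothing)
  insertRow-max [] = refl
  insertRow-max {t} {y ∷ ρ} (y<t ∷ <t) with t Fin.<? y
  ... | yes t<y = contradiction t<y (<-asym y<t)
  ... | no  _   rewrite insertRow-max <t = refl

  insertRow-bumped : ∀ {Z : Fin m → Set} → insertRow x ρ ≡ (ρ′ , just y) → All Z ρ → Z y
  insertRow-bumped {x} {z ∷ ρ} e (Zz ∷ Zρ) with x Fin.<? z
  insertRow-bumped {x} {z ∷ ρ} refl (Zz ∷ Zρ) | yes _ = Zz
  ... | no _ with insertRow x ρ in eq
  insertRow-bumped {x} {z ∷ ρ} refl (Zz ∷ Zρ) | no _ | _ , just _ = insertRow-bumped eq Zρ

  insert-max : Below t P → insert t P ≡ (addToRow 0 t P , 0)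
  insert-max []       = refl
  insert-max (<t ∷ _) rewrite insertRow-max <t = refl

  -- If the insertion of x ends in the very row that t was put in, then t is bumped to the next row.

  insert-addToRow : ∀ r → Below t P → x Fin.< t → r ≤ length P → ∀ {s} → insert x P ≡ (Q , s) →
    (r ≢ s → insert x (addToRow r t P) ≡ (addToRow r t Q , s)) ×
    (r ≡ s → insert x (addToRow r t P) ≡ (addToRow (suc r) t Q , suc r))
  insert-addToRow {t} {[]} {x} zero bt x<t z≤n refl with x Fin.<? t
  ... | yes _  = (λ 0≢0 → contradiction refl 0≢0) , (λ _ → refl)
  ... | no x≮t = contradiction x<t x≮t
  insert-addToRow {t} {ρ ∷ P} {x} r (bρ ∷ bP) x<t r≤ e with insertRow x ρ in eq
  insert-addToRow {t} {ρ ∷ P} {x} zero (bρ ∷ bP) x<t r≤ refl | ρ′ , nothing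
    rewrite insertRow-nothing-∷ʳ {ρ = ρ} x<t eq | insert-max bP = (λ 0≢0 → contradiction refl 0≢0) , (λ _ → refl)
  insert-addToRow {t} {ρ ∷ P} {x} zero (bρ ∷ bP) x<t r≤ refl | ρ′ , just y
    rewrite insertRow-just-∷ʳ {ρ = ρ} t eq = (λ _ → refl) , (λ ())
  insert-addToRow {t} {ρ ∷ P} {x} (suc r) (bρ ∷ bP) x<t r≤ refl | ρ′ , nothing
    rewrite eq = (λ _ → refl) , (λ ())
  insert-addToRow {t} {ρ ∷ P} {x} (suc r) (bρ ∷ bP) x<t (s≤s r≤) refl | ρ′ , just y
    rewrite eq with insert-addToRow {t} {P} {y} r bP (insertRow-bumped eq bρ) r≤ refl
  ... | ne , eq′ = (λ r≢s → cong (λ (P , i) → ρ′ ∷ P , suc i) (ne (λ e → r≢s (cong suc e)))) ,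
                   (λ r≡s → cong (λ (P , i) → ρ′ ∷ P , suc i) (eq′ (suc-injective r≡s)))

  addToRow-All : ∀ {Z : Fin m → Set} r → Z t → All (All Z) P → All (All Z) (addToRow r t P)
  addToRow-All r       Zt []        = (Zt ∷ []) ∷ []
  addToRow-All zero    Zt (Zρ ∷ ZP) = All.++⁺ Zρ (Zt ∷ []) ∷ ZP
  addToRow-All (suc r) Zt (Zρ ∷ ZP) = Zρ ∷ addToRow-All r Zt ZP

  place : Edge → Fin m → Tableau m → Tableau m
  place nothing  t P = P
  place (just r) t P = addToRow r t P

  place-All : ∀ {Z : Fin m → Set} e → Z t → All (All Z) P → All (All Z) (place e t P)
  place-All nothing  Zt ZP = ZP
  place-All (just r) Zt ZP = addToRow-All r Zt ZP

  -- The bound is irrelevant so that the tableau does not depend on its proof. For `w = H i`, an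
  -- edge `nothing` means that the value is not among the first `i` letters.
  tableau : (ℕ → Edge) → (j : ℕ) → .(j ≤ m) → Tableau m
  tableau w zero    _   = []
  tableau w (suc j) j<m = place (w j) (fromℕ< j<m) (tableau w j (<⇒≤ j<m))

  tableau-bounded : ∀ w j .(j≤m : j ≤ m) → All (All λ y → toℕ y < j) (tableau w j j≤m)
  tableau-bounded w zero    _   = []
  tableau-bounded w (suc j) j<m = place-All (w j) (subst (_< suc j) (sym (toℕ-fromℕ< j<m)) (n<1+n j))
    (All.map (All.map m<n⇒m<1+n) (tableau-bounded w j _))

  -- `P` and `Q` hold the values below `j` before and after the letter `x` is inserted. Until `x`
  -- itself is passed they agree; afterwards they are related by an honest insertion, because larger
  -- values never influence where smaller ones go.
  Inserts : Fin m → ℕ → Edge → Tableau m → Tableau m → Set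
  Inserts x j nothing  P Q = Q ≡ P
  Inserts x j (just s) P Q = toℕ x < j × insert x P ≡ (Q , s)

  -- The value `t` exceeds all of `P`. While a smaller `x` is inserted, `t` stays put unless the new
  -- box is to be at the end of its row, when it is bumped one row down. If `x` is `t` itself, it is
  -- appended to the first row, whence the label 0 of a cross.
  Inserts-step : Local χ a b c d → Below t P → (χ ≡ true → x ≡ t) → (∀ {r} → a ≡ just r → r ≤ length P) →
    Inserts x (toℕ t) b P Q → Inserts x (suc (toℕ t)) d (place a t P) (place c t Q)
  Inserts-step blank bP _ _ e = e
  Inserts-step {t = t} cross bP x≡t _ e with x≡t refl
  ... | refl rewrite e = n<1+n (toℕ t) , insert-max bP
  Inserts-step below bP _ _ refl = refl
  Inserts-step aside bP _ _ (x<t , e) = m<n⇒m<1+n x<t , e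
  Inserts-step (apart {r} r≢s) bP _ len (x<t , e) = m<n⇒m<1+n x<t , proj₁ (insert-addToRow r bP x<t (len refl) e) r≢s
  Inserts-step (bump {r}) bP _ len (x<t , e) = m<n⇒m<1+n x<t , proj₂ (insert-addToRow r bP x<t (len refl) e) refl

part : List ℕ → Shape
part []      r       = 0
part (k ∷ l) zero    = k
part (k ∷ l) (suc r) = part l r

part-length : ∀ l r → 0 < part l r → r < length l
part-length (k ∷ l) zero    _  = s≤s z≤n
part-length (k ∷ l) (suc r) 0< = s≤s (part-length l r 0<)

-- Positivity excludes trailing zeros, the only thing that `part` forgets.
part-injective : ∀ {l l′} → All (0 <_) l → All (0 <_) l′ → (∀ r → part l r ≡ part l′ r) → l ≡ l′
part-injective []        []        e = refl
part-injective []        (0<k ∷ _) e = contradiction (e 0) (<⇒≢ 0<k)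
part-injective (0<k ∷ _) []        e = contradiction (sym (e 0)) (<⇒≢ 0<k)
part-injective (_ ∷ p)   (_ ∷ p′)  e = cong₂ _∷_ (e 0) (part-injective p p′ (λ r → e (suc r)))

-- The bound matters: past the first missing row, `addToRow` would start a row with an index other
-- than `r`.
part-addToRow : ∀ r (t : Fin m) P → r ≤ length P → ∀ q → part (shape (addToRow r t P)) q ≡ part (shape P) q + box r q
part-addToRow zero    t []      _ zero    = refl
part-addToRow zero    t []      _ (suc q) = refl
part-addToRow zero    t (ρ ∷ P) _ zero    = length-++ ρ
part-addToRow zero    t (ρ ∷ P) _ (suc q) = sym (+-identityʳ _)
part-addToRow (suc r) t (ρ ∷ P) _ zero    = sym (+-identityʳ _)
part-addToRow (suc r) t (ρ ∷ P) (s≤s r≤) (suc q) = part-addToRow r t P r≤ q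

addToRow-positive : ∀ r (t : Fin m) P → All (0 <_) (shape P) → All (0 <_) (shape (addToRow r t P))
addToRow-positive r       t []      []       = s≤s z≤n ∷ []
addToRow-positive zero    t (ρ ∷ P) (_ ∷ p)  = subst (0 <_) (sym (trans (length-++ ρ) (+-comm (length ρ) 1))) (s≤s z≤n) ∷ p
addToRow-positive (suc r) t (ρ ∷ P) (0< ∷ p) = 0< ∷ addToRow-positive r t P p

tableau-positive : ∀ w j .(j≤m : j ≤ m) → All (0 <_) (shape (tableau {m} w j j≤m))
tableau-positive w zero    _   = []
tableau-positive w (suc j) j<m with w j
... | nothing = tableau-positive w j _
... | just r  = addToRow-positive r _ _ (tableau-positive w j _)

module _ {m : ℕ} {w : ℕ → Edge} (partitions : ∀ {j} → j ≤ m → IsPartition (content w j)) where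

  tableau-shape : ∀ j (j≤m : j ≤ m) r → part (shape (tableau {m} w j j≤m)) r ≡ content w j r
  -- A box in row `suc r` rests on one in row `r`: the content including letter `j` is a partition,
  -- and the new box is not in row `r`, which was therefore occupied before. This supplies the bound
  -- for `tableau-shape`, which in turn is used here for the shorter prefix.
  tableau-length : ∀ j (j<m : j < m) {r} → w j ≡ just r → r ≤ length (tableau {m} w j (<⇒≤ j<m))

  tableau-shape zero    _   r = refl
  tableau-shape (suc j) j<m r with w j in eq
  ... | nothing = trans (tableau-shape j (<⇒≤ j<m) r) (sym (+-identityʳ _))
  ... | just s  = trans (part-addToRow s (fromℕ< j<m) (tableau w j (<⇒≤ j<m)) (tableau-length j j<m eq) r)
                  (cong (_+ box s r) (tableau-shape j (<⇒≤ j<m) r))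

  tableau-length j j<m {zero}  e = z≤n
  tableau-length j j<m {suc r} e = subst (r <_) (length-map length (tableau {m} w j _))
    (part-length (shape (tableau {m} w j _)) r (begin-strict
    0                                   <⟨ s≤s z≤n ⟩
    1                                   ≡⟨ box-self r ⟨
    box (suc r) (suc r)                 ≡⟨ cong (λ e → boxes e (suc r)) e ⟨
    boxes (w j) (suc r)                 ≤⟨ m≤n+m _ _ ⟩
    content w (suc j) (suc r)           ≤⟨ partitions j<m r ⟩
    content w j r + boxes (w j) r       ≡⟨ cong (λ e → content w j r + boxes e r) e ⟩
    content w j r + box (suc r) r       ≡⟨ cong (content w j r +_) (box-≢ (λ p → <⇒≢ (n<1+n r) (sym p))) ⟩
    content w j r + 0                   ≡⟨ +-identityʳ _ ⟩
    content w j r                       ≡⟨ tableau-shape j (<⇒≤ j<m) r ⟨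
    part (shape (tableau {m} w j _)) r  ∎))
    where open ≤-Reasoning

insertAll : Tableau m → List (Fin m) → Tableau m
insertAll = foldl (λ P x → proj₁ (insert x P))

module _ {π : Word m} {H V} (D : Diagram m (crosses π) H V) where

  -- Induction along row `i` of the diagram, one value at a time. At `j = m` the whole tableau of
  -- one horizontal line is carried to that of the next.
  insert-letter : ∀ {i} → i < m → (x : Fin m) → at π i ≡ toℕ x → ∀ j (j≤m : j ≤ m) →
    Inserts x j (V i j) (tableau (H i) j j≤m) (tableau (H (suc i)) j j≤m)
  insert-letter i<m x e zero _ rewrite proj₂ (proj₂ D) i<m = refl
  insert-letter {i} i<m x e (suc j) j<m =
    subst (λ k → Inserts x (suc k) (V i (suc j)) (tableau (H i) (suc j) j<m) (tableau (H (suc i)) (suc j) j<m)) (toℕ-fromℕ< j<m)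
      (Inserts-step (proj₁ D i<m j<m)
        (All.map (All.map (λ {y} → subst (toℕ y <_) (sym (toℕ-fromℕ< j<m)))) (tableau-bounded (H i) j _))
        (λ X → toℕ-injective (trans (sym e) (trans (crosses-true π X) (sym (toℕ-fromℕ< j<m)))))
        (tableau-length (content-partition D i _ (<⇒≤ i<m)) j j<m)
        (subst (λ k → Inserts x k (V i j) (tableau (H i) j (<⇒≤ j<m)) (tableau (H (suc i)) j (<⇒≤ j<m))) (sym (toℕ-fromℕ< j<m))
          (insert-letter i<m x e j (<⇒≤ j<m))))

  insert-suffix : ∀ {l} (xs : Vec (Fin m) l) i → l + i ≡ m → (∀ k → at π (k + i) ≡ at xs k) →
    insertAll (tableau (H i) m ≤-refl) (toList xs) ≡ tableau (H m) m ≤-refl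
  insert-suffix [] i refl e = refl
  insert-suffix {suc l} (x ∷ xs) i li≡m e
    with insert-letter i<m x (e 0) m ≤-refl | cross-Just D i<m m (at-< π i<m) ≤-refl (crosses-at π i)
    where
    i<m : i < m
    i<m = subst (i <_) li≡m (s≤s (m≤n+m i l))
  ... | ins | s , v rewrite v | proj₂ ins = insert-suffix xs (suc i) (trans (+-suc l i) li≡m)
                                               (λ k → trans (cong (at π) (+-suc k i)) (e (suc k)))

  insertAll-tableau : insertAll [] (toList π) ≡ tableau (H m) m ≤-refl
  insertAll-tableau = trans (cong (λ P → insertAll P (toList π)) (sym (empty m ≤-refl)))
    (insert-suffix π 0 (+-identityʳ m) (λ k → cong (at π) (+-identityʳ k)))
    where
    empty : ∀ j (j≤m : j ≤ m) → tableau {m} (H 0) j j≤m ≡ []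
    empty zero    _   = refl
    empty (suc j) j<m = trans
      (cong (λ e → place e (fromℕ< j<m) (tableau (H 0) j (<⇒≤ j<m))) (proj₁ (proj₂ D) j<m)) (empty j (<⇒≤ j<m))

foldl-zip : ∀ {A B C : Set} (f : C × C → A × B → C × C) (g : C → B → C) →
  (∀ P Q t x → proj₁ (f (P , Q) (t , x)) ≡ g P x) →
  ∀ P Q ts xs → length ts ≡ length xs → proj₁ (foldl f (P , Q) (zip ts xs)) ≡ foldl g P xs
foldl-zip f g e P Q [] [] _ = refl
foldl-zip f g e P Q (t ∷ ts) (x ∷ xs) len rewrite sym (e P Q t x) = foldl-zip f g e _ _ ts xs (suc-injective len)

robinsonSchensted-insertAll : (π : Word m) → proj₁ (robinsonSchensted π) ≡ insertAll [] (toList π)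
robinsonSchensted-insertAll {m} π = foldl-zip _ _ (λ _ _ _ _ → refl) [] [] (allFin m) (toList π)
  (trans (length-tabulate (λ i → i)) (sym (length-toList π)))

sh-content : {π : Word m} {H V : ℕ → ℕ → Edge} → Diagram m (crosses π) H V →
  All (0 <_) (sh π) × (∀ r → part (sh π) r ≡ content (H m) m r)
sh-content {m} {π} {H} D = subst (λ P → All (0 <_) (shape P) × (∀ r → part (shape P) r ≡ content (H m) m r))
  (sym (trans (robinsonSchensted-insertAll π) (insertAll-tableau {π = π} D)))
  (tableau-positive (H m) m ≤-refl , tableau-shape (content-partition D m _ ≤-refl) m ≤-refl)

-- Schensted's theorem

firstRow : Tableau m → List (Fin m)
firstRow []      = []
firstRow (ρ ∷ _) = ρ

replace : List (Fin m) → Fin m → List (Fin m)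
replace ρ x = proj₁ (insertRow x ρ)

firstRow-insert : (x : Fin m) (P : Tableau m) → firstRow (proj₁ (insert x P)) ≡ replace (firstRow P) x
firstRow-insert x []      = refl
firstRow-insert x (ρ ∷ P) with insertRow x ρ
... | _ , nothing = refl
... | _ , just _  = refl

firstRow-insertAll : (P : Tableau m) (xs : List (Fin m)) → firstRow (insertAll P xs) ≡ foldl replace (firstRow P) xs
firstRow-insertAll P []       = refl
firstRow-insertAll P (x ∷ xs) = trans (firstRow-insertAll _ xs) (cong (λ ρ → foldl replace ρ xs) (firstRow-insert x P))

module _ {m : ℕ} where

  private variable
    x h : Fin m
    ρ xs σ : List (Fin m)

  under : Fin m → List (Fin m) → ℕ
  under h []      = 0
  under h (y ∷ ρ) with y Fin.<? h
  ... | yes _ = suc (under h ρ)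
  ... | no  _ = 0

  -- The length of the longest increasing sequence made of an initial part of ρ followed by σ.

  weight : List (Fin m) → List (Fin m) → ℕ
  weight ρ []      = length ρ
  weight ρ (h ∷ σ) = under h ρ + suc (length σ)

  replace-All : ∀ {Z : Fin m → Set} ρ → Z x → All Z ρ → All Z (replace ρ x)
  replace-All []      Zx _         = Zx ∷ []
  replace-All {x} (y ∷ ρ) Zx (Zy ∷ Zρ) with x Fin.<? y
  ... | yes _ = Zx ∷ Zρ
  ... | no  _ = Zy ∷ replace-All ρ Zx Zρ

  Sorted : List (Fin m) → Set
  Sorted = AllPairs Fin._<_

  replace-Sorted : ∀ ρ → All (x ≢_) ρ → Sorted ρ → Sorted (replace ρ x)
  replace-Sorted []      _ _ = [] ∷ []
  replace-Sorted {x} (y ∷ ρ) (x≢y ∷ x≢ρ) (y<ρ ∷ sρ) with x Fin.<? y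
  ... | yes x<y = All.map (Fin.<-trans x<y) y<ρ ∷ sρ
  ... | no  x≮y = replace-All ρ (Fin.≤∧≢⇒< (≮⇒≥ x≮y) (≢-sym x≢y)) y<ρ ∷ replace-Sorted ρ x≢ρ sρ

  length-replace : ∀ ρ (x : Fin m) → length ρ ≤ length (replace ρ x)
  length-replace []      x = z≤n
  length-replace (y ∷ ρ) x with x Fin.<? y
  ... | yes _ = ≤-refl
  ... | no  _ = s≤s (length-replace ρ x)

  under-length : ∀ ρ (x : Fin m) → under x ρ < length (replace ρ x)
  under-length []      x = s≤s z≤n
  under-length (y ∷ ρ) x with y Fin.<? x | x Fin.<? y
  ... | yes y<x | yes x<y = contradiction x<y (<-asym y<x)
  ... | yes _   | no  _   = s≤s (under-length ρ x)
  ... | no  _   | yes _   = s≤s z≤n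
  ... | no  _   | no  _   = s≤s z≤n

  under-replace : ∀ ρ (x h : Fin m) → under h ρ ≤ under h (replace ρ x)
  under-replace []      x h = z≤n
  under-replace (y ∷ ρ) x h with x Fin.<? y
  under-replace (y ∷ ρ) x h | yes x<y with y Fin.<? h | x Fin.<? h
  ... | yes _   | yes _   = ≤-refl
  ... | yes y<h | no  x≮h = contradiction (<-trans x<y y<h) x≮h
  ... | no  _   | _       = z≤n
  under-replace (y ∷ ρ) x h | no _ with y Fin.<? h
  ... | yes _ = s≤s (under-replace ρ x h)
  ... | no  _ = z≤n

  under-< : ∀ ρ → x Fin.< h → under x ρ < under h (replace ρ x)
  under-< {x} {h} [] x<h with x Fin.<? h
  ... | yes _  = s≤s z≤n
  ... | no x≮h = contradiction x<h x≮h
  under-< {x} {h} (y ∷ ρ) x<h with x Fin.<? y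
  under-< {x} {h} (y ∷ ρ) x<h | yes x<y with y Fin.<? x | x Fin.<? h
  ... | yes y<x | _       = contradiction x<y (<-asym y<x)
  ... | no _    | yes _   = s≤s z≤n
  ... | no _    | no  x≮h = contradiction x<h x≮h
  under-< {x} {h} (y ∷ ρ) x<h | no x≮y with y Fin.<? h | y Fin.<? x
  ... | yes _   | yes _ = s≤s (under-< ρ x<h)
  ... | yes _   | no  _ = s≤s z≤n
  ... | no  y≮h | _     = contradiction (≤-<-trans (≮⇒≥ x≮y) x<h) y≮h

  -- Induction on the letters still to be read. If σ skips `x`, inserting `x` only lowers an entry
  -- or lengthens the row, so the weight does not drop. If σ starts with `x`, then `x` moves from σ
  -- into the row, where it still precedes the next letter (`under-<`).
  weight-≤ : ∀ xs ρ → σ ∈ subsequences xs → Increasing σ → weight ρ σ ≤ length (foldl replace ρ xs)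
  weight-≤ []       ρ (here refl) _ = ≤-refl
  weight-≤ (x ∷ xs) ρ σ∈ inc with ∈-++⁻ (map (x ∷_) (subsequences xs)) σ∈
  weight-≤ {[]}    (x ∷ xs) ρ _ inc | inj₂ σ∈ = ≤-trans (length-replace ρ x) (weight-≤ xs (replace ρ x) σ∈ inc)
  weight-≤ {h ∷ σ} (x ∷ xs) ρ _ inc | inj₂ σ∈ =
    ≤-trans (+-monoˡ-≤ (suc (length σ)) (under-replace ρ x h)) (weight-≤ xs (replace ρ x) σ∈ inc)
  weight-≤ (x ∷ xs) ρ _ inc | inj₁ σ∈ with ∈-map⁻ (x ∷_) σ∈
  weight-≤ (x ∷ xs) ρ _ inc | inj₁ _ | [] , τ∈ , refl = begin
    under x ρ + 1                           ≡⟨ +-comm _ 1 ⟩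
    suc (under x ρ)                         ≤⟨ under-length ρ x ⟩
    length (replace ρ x)                    ≤⟨ weight-≤ xs (replace ρ x) τ∈ [] ⟩
    length (foldl replace (replace ρ x) xs) ∎
    where open ≤-Reasoning
  weight-≤ (x ∷ xs) ρ _ (x<h ∷ inc) | inj₁ _ | h ∷ τ , τ∈ , refl = begin
    under x ρ + suc (suc (length τ))        ≡⟨ +-suc _ _ ⟩
    suc (under x ρ) + suc (length τ)        ≤⟨ +-monoˡ-≤ (suc (length τ)) (under-< ρ x<h) ⟩
    under h (replace ρ x) + suc (length τ)  ≤⟨ weight-≤ xs (replace ρ x) τ∈ inc ⟩
    length (foldl replace (replace ρ x) xs) ∎
    where open ≤-Reasoning

  length-replace⁻ : ∀ ρ (x : Fin m) → All (x ≢_) ρ → length (replace ρ x) ≤ length ρ ⊎ length (replace ρ x) ≤ suc (under x ρ)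
  length-replace⁻ []      x _ = inj₂ (s≤s z≤n)
  length-replace⁻ (y ∷ ρ) x (x≢y ∷ x≢ρ) with x Fin.<? y
  ... | yes _ = inj₁ ≤-refl
  ... | no x≮y with y Fin.<? x
  ...   | yes _  = Sum.map s≤s s≤s (length-replace⁻ ρ x x≢ρ)
  ...   | no y≮x = contradiction (Fin.≤∧≢⇒< (≮⇒≥ x≮y) (≢-sym x≢y)) y≮x

  under-0 : ∀ ρ {y h : Fin m} → ¬ y Fin.< h → All (y Fin.<_) ρ → under h ρ ≡ 0
  under-0 []      y≮h _ = refl
  under-0 (z ∷ ρ) {y} {h} y≮h (y<z ∷ _) with z Fin.<? h
  ... | yes z<h = contradiction (<-trans y<z z<h) y≮h
  ... | no  _   = refl

  under-replace⁻ : ∀ ρ (x h : Fin m) → All (x ≢_) ρ → Sorted ρ →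
    under h (replace ρ x) ≤ under h ρ ⊎ x Fin.< h × under h (replace ρ x) ≤ suc (under x ρ)
  under-replace⁻ []      x h _ _ with x Fin.<? h
  ... | yes x<h = inj₂ (x<h , s≤s z≤n)
  ... | no  _   = inj₁ z≤n
  under-replace⁻ (y ∷ ρ) x h (x≢y ∷ x≢ρ) (y<ρ ∷ sρ) with x Fin.<? y
  under-replace⁻ (y ∷ ρ) x h (x≢y ∷ x≢ρ) (y<ρ ∷ sρ) | yes x<y with x Fin.<? h | y Fin.<? h
  ... | no  _   | _       = inj₁ z≤n
  ... | yes _   | yes _   = inj₁ ≤-refl
  ... | yes x<h | no y≮h  = inj₂ (x<h , s≤s (≤-trans (≤-reflexive (under-0 ρ y≮h y<ρ)) z≤n))
  under-replace⁻ (y ∷ ρ) x h (x≢y ∷ x≢ρ) (y<ρ ∷ sρ) | no x≮y with y Fin.<? h | y Fin.<? x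
  ... | no  _ | _      = inj₁ z≤n
  ... | yes _ | yes _  = Sum.map s≤s (λ (x<h , u) → x<h , s≤s u) (under-replace⁻ ρ x h x≢ρ sρ)
  ... | yes _ | no y≮x = contradiction (Fin.≤∧≢⇒< (≮⇒≥ x≮y) (≢-sym x≢y)) y≮x

  -- The converse induction: a σ that serves the row after the insertion of `x` either serves the
  -- row before it equally well, or owes its weight to the new entry, and then `x ∷ σ` is taken.
  -- Distinct letters keep the row strictly sorted.
  weight-attained : ∀ xs ρ → Sorted ρ → All (λ x → All (x ≢_) ρ) xs → List.Unique xs →
    ∃[ σ ] σ ∈ subsequences xs × Increasing σ × length (foldl replace ρ xs) ≤ weight ρ σ
  weight-attained []       ρ _ _ _ = [] , here refl , [] , ≤-refl
  weight-attained (x ∷ xs) ρ sρ (x≢ρ ∷ xs≢ρ) (x≢xs ∷ uxs)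
    with weight-attained xs (replace ρ x) (replace-Sorted ρ x≢ρ sρ)
           (All.map (λ {y} (x≢y , y≢ρ) → replace-All ρ (≢-sym x≢y) y≢ρ) (All.zip (x≢xs , xs≢ρ))) uxs
  ... | [] , σ∈ , inc , le with length-replace⁻ ρ x x≢ρ
  ...   | inj₁ le′ = [] , ∈-++⁺ʳ _ σ∈ , [] , ≤-trans le le′
  ...   | inj₂ le′ = [ x ] , ∈-++⁺ˡ (∈-map⁺ (x ∷_) σ∈) , [-] , ≤-trans le (≤-trans le′ (≤-reflexive (+-comm 1 _)))
  weight-attained (x ∷ xs) ρ sρ (x≢ρ ∷ xs≢ρ) (x≢xs ∷ uxs) | h ∷ σ , σ∈ , inc , le with under-replace⁻ ρ x h x≢ρ sρ
  ...   | inj₁ le′ = h ∷ σ , ∈-++⁺ʳ _ σ∈ , inc , ≤-trans le (+-monoˡ-≤ _ le′)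
  ...   | inj₂ (x<h , le′) = x ∷ h ∷ σ , ∈-++⁺ˡ (∈-map⁺ (x ∷_) σ∈) , x<h ∷ inc ,
            ≤-trans le (≤-trans (+-monoˡ-≤ _ le′) (≤-reflexive (sym (+-suc _ _))))

toList-Unique : ∀ {A : Set} {l} {xs : Vec A l} → Unique xs → List.Unique (toList xs)
toList-Unique VecAllPairs.[] = []
toList-Unique (x VecAllPairs.∷ u) = VecAll.toList⁺ x ∷ toList-Unique u

ℓ-patience : {π : Word m} → Unique π → ℓ π ≡ length (foldl replace [] (toList π))
ℓ-patience {π = π} u = ≤-antisym
  (foldr-preservesᵇ {P = _≤ length (foldl replace [] (toList π))} ⊔-lub z≤n (All.map⁺ (All.tabulate λ {σ} σ∈ →
    let σ∈′ , inc = ∈-filter⁻ increasing? σ∈ in lower σ inc (weight-≤ (toList π) [] σ∈′ inc))))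
  upper
  where
  lower : ∀ σ → Increasing σ → weight [] σ ≤ length (foldl replace [] (toList π)) →
          length σ ≤ length (foldl replace [] (toList π))
  lower []      _ le = z≤n
  lower (h ∷ σ) _ le = le
  weight-[] : ∀ (σ : List (Fin _)) → weight [] σ ≡ length σ
  weight-[] []      = refl
  weight-[] (h ∷ σ) = refl
  upper : length (foldl replace [] (toList π)) ≤ ℓ π
  upper with weight-attained (toList π) [] [] (All.universal (λ _ → []) _) (toList-Unique u)
  ... | σ , σ∈ , inc , le = foldr-preservesᵒ {P = _ ≤_} (λ k l → Sum.[ m≤n⇒m≤n⊔o l , m≤n⇒m≤o⊔n k ]) 0 _
        (inj₂ (Any.map⁺ (lose (∈-filter⁺ increasing? σ∈ inc) (≤-trans le (≤-reflexive (weight-[] σ))))))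

schensted : {π : Word m} → Unique π → ℓ π ≡ part (sh π) 0
schensted {π = π} u = trans (ℓ-patience u) (trans (cong length (sym (firstRow-insertAll [] (toList π))))
  (trans (cong (λ P → length (firstRow P)) (sym (robinsonSchensted-insertAll π)))
    (length-firstRow (proj₁ (robinsonSchensted π)))))
  where
  length-firstRow : ∀ P → length (firstRow P) ≡ part (shape P) 0
  length-firstRow []      = refl
  length-firstRow (_ ∷ _) = refl

-- Lattice words with at most four letters

-- A partition into at most four parts, given by the differences of consecutive parts.

rows : (x y z d : ℕ) → Shape
rows x y z d 0 = x + (y + (z + d))
rows x y z d 1 = y + (z + d)
rows x y z d 2 = z + d
rows x y z d 3 = d
rows x y z d (suc (suc (suc (suc _)))) = 0

size : (x y z d : ℕ) → ℕ
size x y z d = x + 2 * y + 3 * z + 4 * d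

rows-partition : ∀ x y z d → IsPartition (rows x y z d)
rows-partition x y z d 0 = m≤n+m _ x
rows-partition x y z d 1 = m≤n+m _ y
rows-partition x y z d 2 = m≤n+m _ z
rows-partition x y z d 3 = z≤n
rows-partition x y z d (suc (suc (suc (suc r)))) = z≤n

rows-box₀ : ∀ x y z d r → rows x y z d r + box 0 r ≡ rows (suc x) y z d r
rows-box₀ x y z d 0 = +-comm _ 1
rows-box₀ x y z d 1 = +-identityʳ _
rows-box₀ x y z d 2 = +-identityʳ _
rows-box₀ x y z d 3 = +-identityʳ _
rows-box₀ x y z d (suc (suc (suc (suc r)))) = refl

rows-box₁ : ∀ x y z d r → rows (suc x) y z d r + box 1 r ≡ rows x (suc y) z d r
rows-box₁ x y z d 0 = trans (+-identityʳ _) (sym (+-suc x _))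
rows-box₁ x y z d 1 = +-comm _ 1
rows-box₁ x y z d 2 = +-identityʳ _
rows-box₁ x y z d 3 = +-identityʳ _
rows-box₁ x y z d (suc (suc (suc (suc r)))) = refl

rows-box₂ : ∀ x y z d r → rows x (suc y) z d r + box 2 r ≡ rows x y (suc z) d r
rows-box₂ x y z d 0 = trans (+-identityʳ _) (cong (x +_) (sym (+-suc y _)))
rows-box₂ x y z d 1 = trans (+-identityʳ _) (sym (+-suc y _))
rows-box₂ x y z d 2 = +-comm _ 1
rows-box₂ x y z d 3 = +-identityʳ _
rows-box₂ x y z d (suc (suc (suc (suc r)))) = refl

rows-box₃ : ∀ x y z d r → rows x y (suc z) d r + box 3 r ≡ rows x y z (suc d) r
rows-box₃ x y z d 0 = trans (+-identityʳ _) (cong (λ e → x + (y + e)) (sym (+-suc z d)))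
rows-box₃ x y z d 1 = trans (+-identityʳ _) (cong (y +_) (sym (+-suc z d)))
rows-box₃ x y z d 2 = trans (+-identityʳ _) (sym (+-suc z d))
rows-box₃ x y z d 3 = +-comm _ 1
rows-box₃ x y z d (suc (suc (suc (suc r)))) = refl

size-suc₁ : ∀ x y z d → size x (suc y) z d ≡ suc (size (suc x) y z d)
size-suc₁ = solve 4 (λ x y z d → x :+ con 2 :* (con 1 :+ y) :+ con 3 :* z :+ con 4 :* d
  := con 1 :+ (con 1 :+ x :+ con 2 :* y :+ con 3 :* z :+ con 4 :* d)) refl

size-suc₂ : ∀ x y z d → size x y (suc z) d ≡ suc (size x (suc y) z d)
size-suc₂ = solve 4 (λ x y z d → x :+ con 2 :* y :+ con 3 :* (con 1 :+ z) :+ con 4 :* d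
  := con 1 :+ (x :+ con 2 :* (con 1 :+ y) :+ con 3 :* z :+ con 4 :* d)) refl

size-suc₃ : ∀ x y z d → size x y z (suc d) ≡ suc (size x y (suc z) d)
size-suc₃ = solve 4 (λ x y z d → x :+ con 2 :* y :+ con 3 :* z :+ con 4 :* (con 1 :+ d)
  := con 1 :+ (x :+ con 2 :* y :+ con 3 :* (con 1 :+ z) :+ con 4 :* d)) refl

onPred : {A : Set} → ℕ → (ℕ → List A) → List A
onPred zero    f = []
onPred (suc n) f = f n

-- The lattice words of length m and content rows x y z d, written backward, one for each standard Young tableau of that
-- shape; meaningful for m = size x y z d only.

latticeWords : (m x y z d : ℕ) → List (Vec ℕ m)
latticeWords zero    x y z d = [ [] ]
latticeWords (suc m) x y z d =
  onPred x (λ x′ → map (0 ∷_) (latticeWords m x′ y z d)) ++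
  onPred y (λ y′ → map (1 ∷_) (latticeWords m (suc x) y′ z d)) ++
  onPred z (λ z′ → map (2 ∷_) (latticeWords m x (suc y) z′ d)) ++
  onPred d (λ d′ → map (3 ∷_) (latticeWords m x y (suc z) d′))

∈-onPred⁻ : ∀ {r} n {f : ℕ → List (Vec ℕ m)} {c} → c ∈ onPred n (λ k → map (r ∷_) (f k)) →
  ∃[ k ] ∃[ c′ ] n ≡ suc k × c′ ∈ f k × c ≡ r ∷ c′
∈-onPred⁻ {r = r} (suc k) c∈ with ∈-map⁻ (r ∷_) c∈
... | c′ , c′∈ , e = k , c′ , refl , c′∈ , e

latticeWords-unique : ∀ m x y z d → List.Unique (latticeWords m x y z d)
latticeWords-unique zero    x y z d = [] ∷ []
latticeWords-unique (suc m) x y z d =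
  ListUnique.++⁺ (block x (λ k → latticeWords-unique m k y z d)) (
  ListUnique.++⁺ (block y (λ k → latticeWords-unique m (suc x) k z d)) (
  ListUnique.++⁺ (block z (λ k → latticeWords-unique m x (suc y) k d)) (block d (λ k → latticeWords-unique m x y (suc z) k))
    (λ (p , q) → <-head z p (head-≥ d q)))
    (λ (p , q) → <-head y p (++-head (onPred z _) (head-≥ z) (λ q → <⇒≤ (head-≥ d q)) q)))
    (λ (p , q) → <-head x p (++-head (onPred y _) (head-≥ y)
      (++-head (onPred z _) (λ q → <⇒≤ (head-≥ z q)) (λ q → <⇒≤ (<⇒≤ (head-≥ d q)))) q))
  where
  block : ∀ {r} n {f : ℕ → List (Vec ℕ m)} → (∀ k → List.Unique (f k)) → List.Unique (onPred n (λ k → map (r ∷_) (f k)))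
  block zero    u = []
  block (suc k) u = ListUnique.map⁺ ∷-injectiveʳ (u k)
  head-≡ : ∀ {r} n {f : ℕ → List (Vec ℕ m)} {c} → c ∈ onPred n (λ k → map (r ∷_) (f k)) → head c ≡ r
  head-≡ n c∈ with ∈-onPred⁻ n c∈
  ... | _ , _ , _ , _ , refl = refl
  head-≥ : ∀ {r} n {f : ℕ → List (Vec ℕ m)} {c} → c ∈ onPred n (λ k → map (r ∷_) (f k)) → r ≤ head c
  head-≥ n c∈ = ≤-reflexive (sym (head-≡ n c∈))
  <-head : ∀ {r} n {f : ℕ → List (Vec ℕ m)} {c} {A : Set} → c ∈ onPred n (λ k → map (r ∷_) (f k)) → r < head c → A
  <-head n c∈ r< = contradiction (head-≡ n c∈) (λ e → <⇒≢ r< (sym e))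
  ++-head : ∀ (xs : List (Vec ℕ (suc m))) {ys r c} →
            (c ∈ xs → r ≤ head c) → (c ∈ ys → r ≤ head c) → c ∈ xs ++ ys → r ≤ head c
  ++-head xs p q c∈ = Sum.[ p , q ] (∈-++⁻ xs c∈)

encode : (ℕ → Edge) → ∀ m → Vec ℕ m
encode w zero    = []
encode w (suc m) = fromMaybe 0 (w m) ∷ encode w m

encode-cong : ∀ {w w′ : ℕ → Edge} m → (∀ {j} → j < m → w j ≡ w′ j) → encode w m ≡ encode w′ m
encode-cong zero    e = refl
encode-cong (suc m) e = cong₂ (λ a c → fromMaybe 0 a ∷ c) (e (n<1+n m)) (encode-cong m (λ j<m → e (m<n⇒m<1+n j<m)))

content-cong : ∀ {w w′ : ℕ → Edge} m → (∀ {j} → j < m → w j ≡ w′ j) → ∀ r → content w m r ≡ content w′ m r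
content-cong zero    e r = refl
content-cong (suc m) e r = cong₂ (λ p a → p + boxes a r) (content-cong m (λ j<m → e (m<n⇒m<1+n j<m)) r) (e (n<1+n m))

encode-injective : ∀ {w w′ : ℕ → Edge} m → (∀ {j} → j < m → Just (w j)) → (∀ {j} → j < m → Just (w′ j)) →
  encode w m ≡ encode w′ m → ∀ {j} → j < m → w j ≡ w′ j
encode-injective (suc m) J J′ e {j} j<1+m with m≤n⇒m<n∨m≡n (≤-pred j<1+m)
... | inj₁ j<m = encode-injective m (λ j<m → J (m<n⇒m<1+n j<m)) (λ j<m → J′ (m<n⇒m<1+n j<m)) (∷-injectiveʳ e) j<m
... | inj₂ refl with J j<1+m | J′ j<1+m
...   | r , p | s , q = trans p (trans (cong just r≡s) (sym q))
  where
  r≡s : r ≡ s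
  r≡s = trans (sym (cong (fromMaybe 0) p)) (trans (cong head e) (cong (fromMaybe 0) q))

-- The last letter marks a removable corner: its row is strictly longer than the next, so the
-- corresponding difference is positive and `onPred` keeps the branch. A zero difference is refuted
-- by `corner`.
encode-∈ : ∀ {w} m x y z d → IsLattice m w → (∀ r → content w m r ≡ rows x y z d r) → encode w m ∈ latticeWords m x y z d
encode-∈ zero x y z d _ _ = here refl
encode-∈ {w} (suc m) x y z d (π , J) e with J (n<1+n m)
... | r , w≡ rewrite w≡ = last r x y z d refl e
  where
  L : IsLattice m w
  L = (λ j≤m → π (m≤n⇒m≤1+n j≤m)) , (λ j<m → J (m<n⇒m<1+n j<m))
  cancel : ∀ r {μ ν : Shape} → (∀ q → content w m q + box r q ≡ μ q) → (∀ q → ν q + box r q ≡ μ q) → ∀ q → content w m q ≡ ν q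
  cancel r e e′ q = +-cancelʳ-≡ (box r q) _ _ (trans (e q) (sym (e′ q)))
  corner : ∀ r {μ : Shape} {A : Set} → (∀ q → content w m q + box r q ≡ μ q) → μ r ≡ μ (suc r) → A
  corner r {μ} e p = contradiction (begin
    suc (content w m r)                     ≡⟨ +-comm 1 _ ⟩
    content w m r + 1                       ≡⟨ cong (content w m r +_) (box-self r) ⟨
    content w m r + box r r                 ≡⟨ trans (e r) (trans p (sym (e (suc r)))) ⟩
    content w m (suc r) + box r (suc r)     ≡⟨ cong (content w m (suc r) +_) (box-≢ (<⇒≢ (n<1+n r))) ⟩
    content w m (suc r) + 0                 ≡⟨ +-identityʳ _ ⟩
    content w m (suc r)                     ≤⟨ proj₁ L ≤-refl r ⟩
    content w m r                           ∎) 1+n≰n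
    where open ≤-Reasoning
  last : ∀ r x y z d {c} → encode w m ≡ c → (∀ q → content w m q + box r q ≡ rows x y z d q) →
         r ∷ c ∈ latticeWords (suc m) x y z d
  last 0 zero    y z d _ e = corner 0 e refl
  last 1 x zero    z d _ e = corner 1 e refl
  last 2 x y zero    d _ e = corner 2 e refl
  last 3 x y z zero    _ e = corner 3 e refl
  last (suc (suc (suc (suc r)))) x y z d _ e = corner (4 + r) e refl
  last 0 (suc x) y z d refl e = ∈-++⁺ˡ (∈-map⁺ (0 ∷_) (encode-∈ m x y z d L (cancel 0 e (rows-box₀ x y z d))))
  last 1 x (suc y) z d refl e = ∈-++⁺ʳ (onPred x _) (∈-++⁺ˡ (∈-map⁺ (1 ∷_)
    (encode-∈ m (suc x) y z d L (cancel 1 e (rows-box₁ x y z d)))))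
  last 2 x y (suc z) d refl e = ∈-++⁺ʳ (onPred x _) (∈-++⁺ʳ (onPred y _) (∈-++⁺ˡ (∈-map⁺ (2 ∷_)
    (encode-∈ m x (suc y) z d L (cancel 2 e (rows-box₂ x y z d))))))
  last 3 x y z (suc d) refl e = ∈-++⁺ʳ (onPred x _) (∈-++⁺ʳ (onPred y _) (∈-++⁺ʳ (onPred z _) (∈-map⁺ (3 ∷_)
    (encode-∈ m x y (suc z) d L (cancel 3 e (rows-box₃ x y z d))))))

Decodes : (m : ℕ) → Shape → Vec ℕ m → Set
Decodes m μ c = ∃[ w ] IsLattice m w × (∀ r → content w m r ≡ μ r) × encode w m ≡ c

decode-snoc : ∀ {m r c} {μ ν : Shape} → Decodes m μ c → (∀ q → μ q + box r q ≡ ν q) → IsPartition ν → Decodes (suc m) ν (r ∷ c)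
decode-snoc {m} {r} {c} {μ} {ν} (w , (π , J) , e , refl) μν πν =
  w′ , (π′ , J′) , e′ , cong₂ _∷_ (cong (fromMaybe 0) w′-last) (encode-cong m w′-old)
  where
  w′ : ℕ → Edge
  w′ j with j ≟ m
  ... | yes _ = just r
  ... | no  _ = w j
  w′-last : w′ m ≡ just r
  w′-last with m ≟ m
  ... | yes _   = refl
  ... | no  m≢m = contradiction refl m≢m
  w′-old : ∀ {j} → j < m → w′ j ≡ w j
  w′-old {j} j<m with j ≟ m
  ... | yes refl = contradiction j<m (<-irrefl refl)
  ... | no  _    = refl
  e′ : ∀ q → content w′ (suc m) q ≡ ν q
  e′ q = trans (cong₂ (λ p a → p + boxes a q) (trans (content-cong m w′-old q) (e q)) w′-last) (μν q)
  π′ : ∀ {j} → j ≤ suc m → IsPartition (content w′ j)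
  π′ {j} j≤ with m≤n⇒m<n∨m≡n j≤
  ... | inj₁ (s≤s j≤m) = IsPartition-resp (λ q → sym (content-cong j (λ k<j → w′-old (<-≤-trans k<j j≤m)) q)) (π j≤m)
  ... | inj₂ refl      = IsPartition-resp (λ q → sym (e′ q)) πν
  J′ : ∀ {j} → j < suc m → Just (w′ j)
  J′ {j} (s≤s j≤m) with m≤n⇒m<n∨m≡n j≤m
  ... | inj₁ j<m  = let s , p = J j<m in s , trans (w′-old j<m) p
  ... | inj₂ refl = r , w′-last

decode : ∀ m x y z d → size x y z d ≡ m → ∀ {c} → c ∈ latticeWords m x y z d → Decodes m (rows x y z d) c
decode zero zero zero zero zero refl (here refl) = (λ _ → nothing) , (π , (λ ())) , empty , refl
  where
  π : ∀ {j} → j ≤ 0 → IsPartition (content (λ _ → nothing) j)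
  π z≤n r = z≤n
  empty : ∀ r → 0 ≡ rows 0 0 0 0 r
  empty 0 = refl
  empty 1 = refl
  empty 2 = refl
  empty 3 = refl
  empty (suc (suc (suc (suc r)))) = refl
decode (suc m) x y z d s c∈ with ∈-++⁻ (onPred x _) c∈
... | inj₁ p with ∈-onPred⁻ x p
...   | x , c , refl , c∈ , refl = decode-snoc (decode m x y z d (suc-injective s) c∈)
                                     (rows-box₀ x y z d) (rows-partition (suc x) y z d)
decode (suc m) x y z d s c∈ | inj₂ p with ∈-++⁻ (onPred y _) p
... | inj₁ p with ∈-onPred⁻ y p
...   | y , c , refl , c∈ , refl = decode-snoc (decode m (suc x) y z d (suc-injective (trans (sym (size-suc₁ x y z d)) s)) c∈)
                                     (rows-box₁ x y z d) (rows-partition x (suc y) z d)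
decode (suc m) x y z d s c∈ | inj₂ p | inj₂ p′ with ∈-++⁻ (onPred z _) p′
... | inj₁ p with ∈-onPred⁻ z p
...   | z , c , refl , c∈ , refl = decode-snoc (decode m x (suc y) z d (suc-injective (trans (sym (size-suc₂ x y z d)) s)) c∈)
                                     (rows-box₂ x y z d) (rows-partition x y (suc z) d)
decode (suc m) x y z d s c∈ | inj₂ p | inj₂ p′ | inj₂ p″ with ∈-onPred⁻ d p″
... | d , c , refl , c∈ , refl = decode-snoc (decode m x y (suc z) d (suc-injective (trans (sym (size-suc₃ x y z d)) s)) c∈)
                                   (rows-box₃ x y z d) (rows-partition x y z (suc d))

-- The number of standard Young tableaux

count : (m x y z d : ℕ) → ℕ
count m x y z d = length (latticeWords m x y z d)

-- With first column hooks l₁ > l₂ > l₃ > l₄, the product of the lᵢ - lⱼ in terms of p = l₁ - l₂, q = l₂ - l₃ and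
-- s = l₃ - l₄.

vandermonde : (p q s : ℕ) → ℕ
vandermonde p q s = p * q * s * (p + q) * (q + s) * (p + q + s)

-- The product of the factorials of the first column hooks lᵢ, the denominator in the Frobenius
-- formula.
hooks : (a b c d : ℕ) → ℕ
hooks a b c d = (3 + a) ! * (2 + b) ! * (1 + c) ! * d !

vandermonde-zero₂ : ∀ p s → vandermonde p 0 s ≡ 0
vandermonde-zero₂ = solve 2 (λ p s → p :* con 0 :* s :* (p :+ con 0) :* (con 0 :+ s) :* (p :+ con 0 :+ s) := con 0) refl

vandermonde-zero₃ : ∀ p q → vandermonde p q 0 ≡ 0
vandermonde-zero₃ = solve 2 (λ p q → p :* q :* con 0 :* (p :+ q) :* (q :+ con 0) :* (p :+ q :+ con 0) := con 0) refl

-- The identity Σ lᵢ Δ(l - eᵢ) = (Σ lᵢ - 6) Δ(l) for the Vandermonde product Δ in four variables; as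
-- 6 = 3 + 2 + 1 + 0, the factor Σ lᵢ - 6 is the number of boxes.
vandermonde-sum : ∀ x y z d →
  (3 + (x + (y + (z + d)))) * vandermonde x (1 + y) (1 + z) + ((2 + (y + (z + d))) * vandermonde (2 + x) y (1 + z) +
  ((1 + (z + d)) * vandermonde (1 + x) (2 + y) z + d * vandermonde (1 + x) (1 + y) (2 + z)))
  ≡ size x y z d * vandermonde (1 + x) (1 + y) (1 + z)
vandermonde-sum = solve 4 (λ x y z d →
  (con 3 :+ (x :+ (y :+ (z :+ d)))) :* vm x (con 1 :+ y) (con 1 :+ z) :+
  ((con 2 :+ (y :+ (z :+ d))) :* vm (con 2 :+ x) y (con 1 :+ z) :+
  ((con 1 :+ (z :+ d)) :* vm (con 1 :+ x) (con 2 :+ y) z :+ d :* vm (con 1 :+ x) (con 1 :+ y) (con 2 :+ z)))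
  := (x :+ con 2 :* y :+ con 3 :* z :+ con 4 :* d) :* vm (con 1 :+ x) (con 1 :+ y) (con 1 :+ z)) refl
  where
  vm : ∀ {k} → (p q s : +-*-Solver.Polynomial k) → +-*-Solver.Polynomial k
  vm p q s = p :* q :* s :* (p :+ q) :* (q :+ s) :* (p :+ q :+ s)

length-++₄ : ∀ (as bs cs ds : List A) →
  length (as ++ bs ++ cs ++ ds) ≡ length as + (length bs + (length cs + length ds))
length-++₄ as bs cs ds = trans (length-++ as) (cong (length as +_) (trans (length-++ bs) (cong (length bs +_) (length-++ cs))))

-- The Frobenius form of the hook length formula, by the branching rule: the vandermonde factor makes the terms of
-- non-removable corners vanish.

frobenius : ∀ m x y z d → size x y z d ≡ m →
  count m x y z d * hooks (x + (y + (z + d))) (y + (z + d)) (z + d) d ≡ m ! * vandermonde (1 + x) (1 + y) (1 + z)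
frobenius zero zero zero zero zero s = refl
frobenius (suc m) x y z d s = begin
  count (suc m) x y z d * h                          ≡⟨ cong (_* h) (length-++₄ (onPred x _) (onPred y _) (onPred z _) (onPred d _)) ⟩
  (M₀ + (M₁ + (M₂ + M₃))) * h
    ≡⟨ solve 5 (λ p q r s h → (p :+ (q :+ (r :+ s))) :* h := p :* h :+ (q :* h :+ (r :* h :+ s :* h)))
         refl M₀ M₁ M₂ M₃ h ⟩
  M₀ * h + (M₁ * h + (M₂ * h + M₃ * h))
    ≡⟨ cong₂ _+_ (e₀ x y z d s) (cong₂ _+_ (e₁ x y z d s) (cong₂ _+_ (e₂ x y z d s) (e₃ x y z d s))) ⟩
  l₀ * (m ! * v₀) + (l₁ * (m ! * v₁) + (l₂ * (m ! * v₂) + d * (m ! * v₃)))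
    ≡⟨ solve 9 (λ f l₀ l₁ l₂ d v₀ v₁ v₂ v₃ → l₀ :* (f :* v₀) :+ (l₁ :* (f :* v₁) :+ (l₂ :* (f :* v₂) :+ d :* (f :* v₃)))
                := f :* (l₀ :* v₀ :+ (l₁ :* v₁ :+ (l₂ :* v₂ :+ d :* v₃)))) refl (m !) l₀ l₁ l₂ d v₀ v₁ v₂ v₃ ⟩
  m ! * (l₀ * v₀ + (l₁ * v₁ + (l₂ * v₂ + d * v₃)))   ≡⟨ cong (m ! *_) (vandermonde-sum x y z d) ⟩
  m ! * (size x y z d * v)                           ≡⟨ cong (λ e → m ! * (e * v)) s ⟩
  m ! * (suc m * v)                                  ≡⟨ solve 3 (λ f k v → f :* (k :* v) := k :* f :* v) refl (m !) (suc m) v ⟩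
  suc m ! * v ∎
  where
  open ≡-Reasoning
  hook : (x y z d : ℕ) → ℕ
  hook x y z d = hooks (x + (y + (z + d))) (y + (z + d)) (z + d) d
  h = hook x y z d
  l₀ = 3 + (x + (y + (z + d)))
  l₁ = 2 + (y + (z + d))
  l₂ = 1 + (z + d)
  v  = vandermonde (1 + x) (1 + y) (1 + z)
  v₀ = vandermonde x (1 + y) (1 + z)
  v₁ = vandermonde (2 + x) y (1 + z)
  v₂ = vandermonde (1 + x) (2 + y) z
  v₃ = vandermonde (1 + x) (1 + y) (2 + z)
  m₀ m₁ m₂ m₃ : (x y z d : ℕ) → ℕ
  m₀ x y z d = length (onPred x (λ x′ → map (0 ∷_) (latticeWords m x′ y z d)))
  m₁ x y z d = length (onPred y (λ y′ → map (1 ∷_) (latticeWords m (suc x) y′ z d)))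
  m₂ x y z d = length (onPred z (λ z′ → map (2 ∷_) (latticeWords m x (suc y) z′ d)))
  m₃ x y z d = length (onPred d (λ d′ → map (3 ∷_) (latticeWords m x y (suc z) d′)))
  M₀ = m₀ x y z d
  M₁ = m₁ x y z d
  M₂ = m₂ x y z d
  M₃ = m₃ x y z d
  -- Removing a box from row i turns lᵢ ! into (lᵢ - 1) !, so the hook product loses just the factor
  -- `k` = lᵢ. `E` belongs to the larger shape, the `f`s to the smaller one.
  scale : ∀ (r k f₁ f₂ f₃ f₄ : ℕ) {E V} (L : List (Vec ℕ m)) → E ≡ k * (f₁ * f₂ * f₃ * f₄) →
    length L * (f₁ * f₂ * f₃ * f₄) ≡ m ! * V → length (map (r ∷_) L) * E ≡ k * (m ! * V)
  scale r k f₁ f₂ f₃ f₄ {V = V} L refl e = begin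
    length (map (r ∷_) L) * (k * (f₁ * f₂ * f₃ * f₄)) ≡⟨ cong (_* (k * (f₁ * f₂ * f₃ * f₄))) (length-map (r ∷_) L) ⟩
    length L * (k * (f₁ * f₂ * f₃ * f₄))
      ≡⟨ solve 3 (λ l k t → l :* (k :* t) := k :* (l :* t)) refl (length L) k (f₁ * f₂ * f₃ * f₄) ⟩
    k * (length L * (f₁ * f₂ * f₃ * f₄))              ≡⟨ cong (k *_) e ⟩
    k * (m ! * V) ∎
  vanish : ∀ l N {V} → V ≡ 0 → 0 ≡ l * (N * V)
  vanish l N refl = sym (trans (cong (l *_) (*-zeroʳ N)) (*-zeroʳ l))
  e₀ : ∀ x y z d → size x y z d ≡ suc m →
    m₀ x y z d * hook x y z d ≡ (3 + (x + (y + (z + d)))) * (m ! * vandermonde x (1 + y) (1 + z))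
  e₀ zero    y z d s = vanish (3 + (y + (z + d))) (m !) refl
  e₀ (suc x) y z d s = scale 0 (4 + (x + (y + (z + d)))) f₁ f₂ f₃ f₄ (latticeWords m x y z d)
    (solve 5 (λ k f₁ f₂ f₃ f₄ → k :* f₁ :* f₂ :* f₃ :* f₄ := k :* (f₁ :* f₂ :* f₃ :* f₄)) refl (4 + (x + (y + (z + d)))) f₁ f₂ f₃ f₄)
    (frobenius m x y z d (suc-injective s))
    where
    f₁ = (3 + (x + (y + (z + d)))) !
    f₂ = (2 + (y + (z + d))) !
    f₃ = (1 + (z + d)) !
    f₄ = d !
  e₁ : ∀ x y z d → size x y z d ≡ suc m →
    m₁ x y z d * hook x y z d ≡ (2 + (y + (z + d))) * (m ! * vandermonde (2 + x) y (1 + z))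
  e₁ x zero    z d s = vanish (2 + (z + d)) (m !) (vandermonde-zero₂ (2 + x) (1 + z))
  e₁ x (suc y) z d s = scale 1 (3 + (y + (z + d))) f₁ f₂ f₃ f₄ (latticeWords m (suc x) y z d)
    (trans (cong (λ a → hooks a (suc (y + (z + d))) (z + d) d) (+-suc x (y + (z + d))))
      (solve 5 (λ k f₁ f₂ f₃ f₄ → f₁ :* (k :* f₂) :* f₃ :* f₄ := k :* (f₁ :* f₂ :* f₃ :* f₄)) refl (3 + (y + (z + d))) f₁ f₂ f₃ f₄))
    (frobenius m (suc x) y z d (suc-injective (trans (sym (size-suc₁ x y z d)) s)))
    where
    f₁ = (4 + (x + (y + (z + d)))) !
    f₂ = (2 + (y + (z + d))) !
    f₃ = (1 + (z + d)) !
    f₄ = d !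
  e₂ : ∀ x y z d → size x y z d ≡ suc m →
    m₂ x y z d * hook x y z d ≡ (1 + (z + d)) * (m ! * vandermonde (1 + x) (2 + y) z)
  e₂ x y zero    d s = vanish (1 + d) (m !) (vandermonde-zero₃ (1 + x) (2 + y))
  e₂ x y (suc z) d s = scale 2 (2 + (z + d)) f₁ f₂ f₃ f₄ (latticeWords m x (suc y) z d)
    (trans (cong (λ b → hooks (x + b) b (suc (z + d)) d) (+-suc y (z + d)))
      (solve 5 (λ k f₁ f₂ f₃ f₄ → f₁ :* f₂ :* (k :* f₃) :* f₄ := k :* (f₁ :* f₂ :* f₃ :* f₄)) refl (2 + (z + d)) f₁ f₂ f₃ f₄))
    (frobenius m x (suc y) z d (suc-injective (trans (sym (size-suc₂ x y z d)) s)))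
    where
    f₁ = (3 + (x + suc (y + (z + d)))) !
    f₂ = (3 + (y + (z + d))) !
    f₃ = (1 + (z + d)) !
    f₄ = d !
  e₃ : ∀ x y z d → size x y z d ≡ suc m →
    m₃ x y z d * hook x y z d ≡ d * (m ! * vandermonde (1 + x) (1 + y) (2 + z))
  -- In an empty last row it is the factor l₄ = 0 that removes the term, not the Vandermonde
  -- product.
  e₃ x y z zero    s = refl
  e₃ x y z (suc d) s = scale 3 (suc d) f₁ f₂ f₃ f₄ (latticeWords m x y (suc z) d)
    (trans (cong (λ c → hooks (x + (y + c)) (y + c) c (suc d)) (+-suc z d))
      (solve 5 (λ k f₁ f₂ f₃ f₄ → f₁ :* f₂ :* f₃ :* (k :* f₄) := k :* (f₁ :* f₂ :* f₃ :* f₄)) refl (suc d) f₁ f₂ f₃ f₄))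
    (frobenius m x y (suc z) d (suc-injective (trans (sym (size-suc₃ x y z d)) s)))
    where
    f₁ = (3 + (x + (y + suc (z + d)))) !
    f₂ = (2 + (y + suc (z + d))) !
    f₃ = (2 + (z + d)) !
    f₄ = d !

-- Counting permutations and involutions

unique-lookup-injective : ∀ {xs : List A} → List.Unique xs → ∀ {i j} → List.lookup xs i ≡ List.lookup xs j → i ≡ j
unique-lookup-injective (x∉ ∷ u) {zero}  {zero}  e = refl
unique-lookup-injective (x∉ ∷ u) {zero}  {suc j} e = contradiction e (All.lookup x∉ (∈-lookup j))
unique-lookup-injective (x∉ ∷ u) {suc i} {zero}  e = contradiction (sym e) (All.lookup x∉ (∈-lookup i))
unique-lookup-injective (x∉ ∷ u) {suc i} {suc j} e = cong suc (unique-lookup-injective u e)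

-- A relation instead of a function, because partners may be built from membership proofs: only
-- pairs of lattice words are realized by permutations.
length-≤ : ∀ {xs : List A} {ys : List B} (R : A → B → Set) → List.Unique xs →
  (∀ {x} → x ∈ xs → ∃[ y ] y ∈ ys × R x y) → (∀ {x x′ y} → R x y → R x′ y → x ≡ x′) → length xs ≤ length ys
length-≤ {xs = xs} {ys} R u total injective = injective⇒≤ {f = λ i → Any.index (proj₁ (proj₂ (image i)))} λ {i} {j} e →
  unique-lookup-injective u (injective (related i) (subst (R (List.lookup xs j)) (cong (List.lookup ys) (sym e)) (related j)))
  where
  image : ∀ i → ∃[ y ] y ∈ ys × R (List.lookup xs i) y
  image i = total (∈-lookup i)
  related : ∀ i → R (List.lookup xs i) (List.lookup ys (Any.index (proj₁ (proj₂ (image i)))))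
  related i = let y , y∈ , r = image i in subst (R (List.lookup xs i)) (Any.lookup-index y∈) r

length-≡ : ∀ {xs : List A} {ys : List B} (R : A → B → Set) → List.Unique xs → List.Unique ys →
  (∀ {x} → x ∈ xs → ∃[ y ] y ∈ ys × R x y) → (∀ {y} → y ∈ ys → ∃[ x ] x ∈ xs × R x y) →
  (∀ {x x′ y} → R x y → R x′ y → x ≡ x′) → (∀ {x y y′} → R x y → R x y′ → y ≡ y′) → length xs ≡ length ys
length-≡ R ux uy total surjective injective functional =
  ≤-antisym (length-≤ R ux total injective) (length-≤ (flip R) uy surjective functional)

length-cartesianProduct : ∀ (xs : List A) (ys : List B) → length (cartesianProduct xs ys) ≡ length xs * length ys
length-cartesianProduct []       ys = refl
length-cartesianProduct (x ∷ xs) ys = trans (length-++ (map (x ,_) ys))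
  (cong₂ _+_ (length-map (x ,_) ys) (length-cartesianProduct xs ys))

words-unique : ∀ m l → List.Unique (words m l)
words-unique m zero    = [] ∷ []
words-unique m (suc l) = ListUnique.cartesianProductWith⁺ _∷_ ∷-injective (ListUnique.allFin⁺ m) (words-unique m l)

∈-words : ∀ {l} (π : Vec (Fin m) l) → π ∈ words m l
∈-words []      = here refl
∈-words (x ∷ π) = ∈-cartesianProductWith⁺ _∷_ (∈-allFin x) (∈-words π)

𝔖-unique : ∀ m → List.Unique (𝔖 m)
𝔖-unique m = ListUnique.filter⁺ unique? (words-unique m m)

∈-𝔖 : {π : Word m} → Unique π → π ∈ 𝔖 m
∈-𝔖 {π = π} = ∈-filter⁺ unique? (∈-words π)

crosses-determine : (π ρ : Word m) → (∀ {i j} → i < m → j < m → crosses π i j ≡ crosses ρ i j) → π ≡ ρ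
crosses-determine π ρ e = at-ext π ρ λ {i} i<m → sym (crosses-true ρ (trans (sym (e i<m (at-< π i<m))) (crosses-at π i)))

-- Involutions as symmetric diagrams

Symmetric : Word m → Set
Symmetric {m} π = ∀ {i j} → i < m → j < m → crosses π i j ≡ crosses π j i

involution-crosses : {π : Word m} → Involution π → ∀ {i j} → i < m → crosses π i j ≡ true → crosses π j i ≡ true
involution-crosses {π = π} inv {i} {j} i<m e = trans (cong (crosses π j) (begin
  i                           ≡⟨ toℕ-fromℕ< i<m ⟨
  toℕ k                       ≡⟨ cong toℕ (inv k) ⟨
  toℕ (lookup π (lookup π k)) ≡⟨ at-lookup π (lookup π k) ⟨
  at π (toℕ (lookup π k))     ≡⟨ cong (at π) (at-lookup π k) ⟨
  at π (at π (toℕ k))         ≡⟨ cong (λ l → at π (at π l)) (toℕ-fromℕ< i<m) ⟩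
  at π (at π i)               ≡⟨ cong (at π) (crosses-true π e) ⟩
  at π j                      ∎)) (crosses-at π j)
  where
  open ≡-Reasoning
  k = fromℕ< i<m

involution⇒symmetric : {π : Word m} → Involution π → Symmetric π
involution⇒symmetric {m} {π} inv {i} {j} i<m j<m with crosses π i j in e | crosses π j i in e′
... | true  | true  = refl
... | false | false = refl
... | true  | false = trans (sym (involution-crosses {π = π} inv i<m e)) e′
... | false | true  = trans (sym e) (involution-crosses {π = π} inv j<m e′)

symmetric⇒involution : {π : Word m} → Symmetric π → Involution π
symmetric⇒involution {m} {π} s i = toℕ-injective (begin
  toℕ (lookup π (lookup π i)) ≡⟨ at-lookup π (lookup π i) ⟨
  at π (toℕ (lookup π i))     ≡⟨ crosses-true π (trans (s (toℕ<n (lookup π i)) (toℕ<n i))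
                                   (trans (cong (crosses π (toℕ i)) (sym (at-lookup π i))) (crosses-at π (toℕ i)))) ⟩
  toℕ i                       ∎)
  where open ≡-Reasoning

module _ (π : Word m) where

  top right : ℕ → Edge
  top   j = Grow.H (crosses π) m j
  right i = Grow.V (crosses π) i m

  insertionWord recordingWord : Vec ℕ m
  insertionWord = encode top m
  recordingWord = encode right m

determined-by-words : {π ρ : Word m} → Unique π → Unique ρ →
  insertionWord π ≡ insertionWord ρ → recordingWord π ≡ recordingWord ρ → π ≡ ρ
determined-by-words {m} {π} {ρ} uπ uρ e e′ = crosses-determine π ρ (Diagram-backward Dπ Dρ
  (encode-injective m (top-Just uπ Dπ) (top-Just uρ Dρ) e) (encode-injective m (right-Just uπ Dπ) (right-Just uρ Dρ) e′))
  where
  Dπ = permutation-diagram uπ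
  Dρ = permutation-diagram uρ

-- The transposed diagram has the same crosses, so growing forward gives the same edges;
-- transposition exchanges the top and the right word.
involution-words : {π : Word m} → Unique π → Involution π → insertionWord π ≡ recordingWord π
involution-words {m} {π} u inv = encode-cong m (λ {j} → proj₁ same ≤-refl)
  where
  D = permutation-diagram u
  same = Diagram-forward (involution⇒symmetric {π = π} inv) D (Diagram-transpose D)

-- The diagram and its transpose share their outer edges, so filling backward gives them the same
-- crosses.
words-involution : {π : Word m} → Unique π → (∀ {j} → j < m → top π j ≡ right π j) → Involution π
words-involution {π = π} u e = symmetric⇒involution {π = π} (Diagram-backward D (Diagram-transpose D) e (λ i<m → sym (e i<m)))
  where D = permutation-diagram u

-- Permutations of shape (k, k, n - k, n - k)

part-filter : ∀ {k} j → 1 ≤ k → ∀ r →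
  part (filter (0 <?_) (k ∷ k ∷ j ∷ j ∷ [])) r ≡ part (k ∷ k ∷ j ∷ j ∷ []) r
part-filter {suc k} zero    _ 0 = refl
part-filter {suc k} zero    _ 1 = refl
part-filter {suc k} zero    _ 2 = refl
part-filter {suc k} zero    _ 3 = refl
part-filter {suc k} zero    _ (suc (suc (suc (suc r)))) = refl
part-filter {suc k} (suc j) _ r = refl

part-twoDoubleRows : ∀ {n k} → 1 ≤ k → ∀ r → part (twoDoubleRows n k) r ≡ part (k ∷ k ∷ n ∸ k ∷ n ∸ k ∷ []) r
part-twoDoubleRows {n} {k} = part-filter (n ∸ k)

-- The index `k` of the shape is its first part, which Schensted's theorem identifies with `ℓ π`;
-- `k = 0` would force `n = 0`.
D2Row-first : ∀ {n μ} → 1 ≤ n → D2Row n μ → n ≤ 2 * part μ 0 × μ ≡ twoDoubleRows n (part μ 0)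
D2Row-first {n} 1≤n (zero  , _ , n≤0 , _) = contradiction (≤-trans 1≤n n≤0) λ ()
D2Row-first {n} 1≤n (suc k , _ , n≤2k , refl) = n≤2k , refl

D2Row-twoDoubleRows : ∀ {n k} → k ≤ n → n ≤ 2 * k → D2Row n (twoDoubleRows n k)
D2Row-twoDoubleRows {k = k} k≤n n≤2k = k , s≤s k≤n , n≤2k , refl

D2Row-ℓ : ∀ {n} → 1 ≤ n → {π : Word (2 * n)} → Unique π → D2Row n (sh π) → n ≤ 2 * ℓ π
D2Row-ℓ 1≤n u d = subst (λ k → _ ≤ 2 * k) (sym (schensted u)) (proj₁ (D2Row-first 1≤n d))

size-two-rows : ∀ y j → size 0 y 0 j ≡ 2 * (y + j + j)
size-two-rows = solve 2 (λ y j → con 0 :+ con 2 :* y :+ con 3 :* con 0 :+ con 4 :* j := con 2 :* (y :+ j :+ j)) refl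

-- Here `y` is 2k - n and `j` is n - k, so that k and n become sums and n / 2 ≤ k ≤ n holds by
-- construction. The differences of consecutive parts of (k, k, n - k, n - k) are 0, `y`, 0, `j`.
module _ (y j : ℕ) (1≤k : 1 ≤ y + j) where

  private
    k n : ℕ
    k = y + j
    n = k + j

    twoDoubleRows-rows : ∀ r → part (twoDoubleRows n k) r ≡ rows 0 y 0 j r
    twoDoubleRows-rows r = trans (part-twoDoubleRows {n} 1≤k r)
      (trans (cong (λ i → part (k ∷ k ∷ i ∷ i ∷ []) r) (m+n∸m≡n k j)) (parts r))
      where
      parts : ∀ r → part (k ∷ k ∷ j ∷ j ∷ []) r ≡ rows 0 y 0 j r
      parts 0 = refl
      parts 1 = refl
      parts 2 = refl
      parts 3 = refl
      parts (suc (suc (suc (suc r)))) = refl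

    k≤n : k ≤ n
    k≤n = m≤m+n k j

    n≤2k : n ≤ 2 * k
    n≤2k = +-monoʳ-≤ k (≤-trans (m≤n+m j y) (m≤m+n k 0))

    Wanted : Word (2 * n) → Set
    Wanted π = ℓ π ≡ k × D2Row n (sh π)

    wanted-content : ∀ {π} → Unique π → Wanted π → ∀ r → content (top π) (2 * n) r ≡ rows 0 y 0 j r
    wanted-content {π} u (ℓ≡k , d) r = begin
      content (top π) (2 * n) r              ≡⟨ proj₂ (sh-content {π = π} (permutation-diagram u)) r ⟨
      part (sh π) r                          ≡⟨ cong (λ μ → part μ r) (proj₂ (D2Row-first (≤-trans 1≤k k≤n) d)) ⟩
      part (twoDoubleRows n (part (sh π) 0)) r ≡⟨ cong (λ i → part (twoDoubleRows n i) r) (trans (sym (schensted u)) ℓ≡k) ⟩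
      part (twoDoubleRows n k) r             ≡⟨ twoDoubleRows-rows r ⟩
      rows 0 y 0 j r                         ∎
      where open ≡-Reasoning

    content-wanted : ∀ {π} → Unique π → (∀ r → content (top π) (2 * n) r ≡ rows 0 y 0 j r) → Wanted π
    content-wanted {π} u e = trans (schensted u) (trans (cong (λ μ → part μ 0) sh≡) (twoDoubleRows-rows 0)) ,
      subst (D2Row n) (sym sh≡) (D2Row-twoDoubleRows k≤n n≤2k)
      where
      sh≡ : sh π ≡ twoDoubleRows n k
      sh≡ = let pos , parts = sh-content {π = π} (permutation-diagram u) in
        part-injective pos (All.all-filter (0 <?_) (k ∷ k ∷ n ∸ k ∷ n ∸ k ∷ []))
          (λ r → trans (parts r) (trans (e r) (sym (twoDoubleRows-rows r))))

    Y : List (Vec ℕ (2 * n))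
    Y = latticeWords (2 * n) 0 y 0 j

    Y-unique : List.Unique Y
    Y-unique = latticeWords-unique (2 * n) 0 y 0 j

    insertionWord-∈ : ∀ {π} → Unique π → Wanted π → insertionWord π ∈ Y
    insertionWord-∈ u w = encode-∈ (2 * n) 0 y 0 j (top-lattice u (permutation-diagram u)) (wanted-content u w)

    recordingWord-∈ : ∀ {π} → Unique π → Wanted π → recordingWord π ∈ Y
    recordingWord-∈ u w = encode-∈ (2 * n) 0 y 0 j (right-lattice u D)
      (λ r → trans (sym (content-transpose D (2 * n) (2 * n) ≤-refl ≤-refl r)) (wanted-content u w r))
      where D = permutation-diagram u

    realize : ∀ {c c′} → c ∈ Y → c′ ∈ Y → ∃[ π ] Unique π × Wanted π × insertionWord π ≡ c × recordingWord π ≡ c′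
    realize c∈ c′∈ with decode (2 * n) 0 y 0 j (size-two-rows y j) c∈ | decode (2 * n) 0 y 0 j (size-two-rows y j) c′∈
    ... | w , L , e , refl | w′ , L′ , e′ , refl with lattice-permutation L L′ (λ r → trans (e r) (sym (e′ r)))
    ...   | π , u , edges = π , u , content-wanted u (λ r → trans (content-cong (2 * n) h r) (e r)) ,
            encode-cong (2 * n) h , encode-cong (2 * n) v
      where
      h = proj₁ (edges (permutation-diagram u))
      v = proj₂ (edges (permutation-diagram u))

    words-equal : ∀ {π} → Unique π → insertionWord π ≡ recordingWord π → ∀ {i} → i < 2 * n → top π i ≡ right π i
    words-equal u = encode-injective (2 * n) (top-Just u D) (right-Just u D)
      where D = permutation-diagram u

  ℓ-d2row-count : ℓ-d2row n k ≡ count (2 * n) 0 y 0 j * count (2 * n) 0 y 0 j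
  ℓ-d2row-count = trans (length-≡ R (ListUnique.filter⁺ P? (𝔖-unique (2 * n))) (ListUnique.cartesianProduct⁺ Y-unique Y-unique)
      total surjective injective functional)
    (length-cartesianProduct Y Y)
    where
    P? = λ (π : Word (2 * n)) → ℓ π ≟ k ×-dec d2row? n (sh π)
    R : Word (2 * n) → Vec ℕ (2 * n) × Vec ℕ (2 * n) → Set
    R π c = Unique π × (insertionWord π , recordingWord π) ≡ c
    total : ∀ {π} → π ∈ filter P? (𝔖 (2 * n)) → ∃[ c ] c ∈ cartesianProduct Y Y × R π c
    total π∈ = let π∈𝔖 , w = ∈-filter⁻ P? {xs = 𝔖 (2 * n)} π∈
                   _ , u = ∈-filter⁻ unique? {xs = words (2 * n) (2 * n)} π∈𝔖 in
      _ , ∈-cartesianProduct⁺ (insertionWord-∈ u w) (recordingWord-∈ u w) , u , refl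
    surjective : ∀ {c} → c ∈ cartesianProduct Y Y → ∃[ π ] π ∈ filter P? (𝔖 (2 * n)) × R π c
    surjective c∈ = let c₁∈ , c₂∈ = ∈-cartesianProduct⁻ Y Y c∈
                        π , u , w , e , e′ = realize c₁∈ c₂∈ in
      π , ∈-filter⁺ P? (∈-𝔖 u) w , u , cong₂ _,_ e e′
    injective : ∀ {π ρ c} → R π c → R ρ c → π ≡ ρ
    injective (u , refl) (u′ , e) = let e₁ , e₂ = ,-injective (sym e) in determined-by-words u u′ e₁ e₂
    functional : ∀ {π c c′} → R π c → R π c′ → c ≡ c′
    functional (_ , refl) (_ , refl) = refl

  i-d2row-count : i-d2row n k ≡ count (2 * n) 0 y 0 j
  i-d2row-count = length-≡ R (ListUnique.filter⁺ P? (𝔖-unique (2 * n))) Y-unique total surjective injective functional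
    where
    P? = λ (π : Word (2 * n)) → involution? π ×-dec ℓ π ≟ k ×-dec d2row? n (sh π)
    R : Word (2 * n) → Vec ℕ (2 * n) → Set
    R π c = Unique π × Involution π × insertionWord π ≡ c
    total : ∀ {π} → π ∈ filter P? (𝔖 (2 * n)) → ∃[ c ] c ∈ Y × R π c
    total π∈ = let π∈𝔖 , inv , w = ∈-filter⁻ P? {xs = 𝔖 (2 * n)} π∈
                   _ , u = ∈-filter⁻ unique? {xs = words (2 * n) (2 * n)} π∈𝔖 in
      _ , insertionWord-∈ u w , u , inv , refl
    surjective : ∀ {c} → c ∈ Y → ∃[ π ] π ∈ filter P? (𝔖 (2 * n)) × R π c
    -- One word used on both borders is realized by an involution.
    surjective c∈ = let π , u , w , e , e′ = realize c∈ c∈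
                        inv = words-involution u (words-equal u (trans e (sym e′))) in
      π , ∈-filter⁺ P? (∈-𝔖 u) (inv , w) , u , inv , e
    injective : ∀ {π ρ c} → R π c → R ρ c → π ≡ ρ
    injective (u , inv , refl) (u′ , inv′ , e) = determined-by-words u u′ (sym e)
      (trans (sym (involution-words u inv)) (trans (sym e) (involution-words u′ inv′)))
    functional : ∀ {π c c′} → R π c → R π c′ → c ≡ c′
    functional (_ , _ , refl) (_ , _ , refl) = refl

filter-none : ∀ {P : A → Set} (P? : Decidable P) xs → (∀ {x} → x ∈ xs → ¬ P x) → length (filter P? xs) ≡ 0
filter-none P? xs none with filter P? xs in eq
... | []     = refl
... | x ∷ ys = let x∈ , Px = ∈-filter⁻ P? {xs = xs} (subst (x ∈_) (sym eq) (here refl)) in contradiction Px (none x∈)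

ℓ-d2row-small : ∀ {n k} → 1 ≤ n → 2 * k < n → ℓ-d2row n k ≡ 0
ℓ-d2row-small {n} 1≤n 2k<n = filter-none _ (𝔖 (2 * n)) λ { π∈ (refl , d) →
  <⇒≱ 2k<n (D2Row-ℓ 1≤n (proj₂ (∈-filter⁻ unique? {xs = words (2 * n) (2 * n)} π∈)) d) }

i-d2row-small : ∀ {n k} → 1 ≤ n → 2 * k < n → i-d2row n k ≡ 0
i-d2row-small {n} 1≤n 2k<n = filter-none _ (𝔖 (2 * n)) λ { π∈ (_ , refl , d) →
  <⇒≱ 2k<n (D2Row-ℓ 1≤n (proj₂ (∈-filter⁻ unique? {xs = words (2 * n) (2 * n)} π∈)) d) }

-- Log concavity

interchange : ∀ a b c d → (a * b) * (c * d) ≡ (a * c) * (b * d)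
interchange = solve 4 (λ a b c d → (a :* b) :* (c :* d) := (a :* c) :* (b :* d)) refl

-- This is log concavity of fᵢ = N pᵢ / Dᵢ for p log concave and D log convex; multiplying by D₁²
-- and cancelling it at the end avoids division.
log-concave-quotient : ∀ {N f₀ f₁ f₂ D₀ D₁ D₂ p₀ p₁ p₂} .{{_ : NonZero D₁}} →
  f₀ * D₀ ≡ N * p₀ → f₁ * D₁ ≡ N * p₁ → f₂ * D₂ ≡ N * p₂ →
  D₁ * D₁ ≤ D₀ * D₂ → p₀ * p₂ ≤ p₁ * p₁ → f₀ * f₂ ≤ f₁ * f₁
log-concave-quotient {N} {f₀} {f₁} {f₂} {D₀} {D₁} {D₂} {p₀} {p₁} {p₂} e₀ e₁ e₂ D≤ p≤ =
  *-cancelʳ-≤ (f₀ * f₂) (f₁ * f₁) (D₁ * D₁) {{m*n≢0 D₁ D₁}} (begin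
    (f₀ * f₂) * (D₁ * D₁) ≤⟨ *-monoʳ-≤ (f₀ * f₂) D≤ ⟩
    (f₀ * f₂) * (D₀ * D₂) ≡⟨ interchange f₀ f₂ D₀ D₂ ⟩
    (f₀ * D₀) * (f₂ * D₂) ≡⟨ cong₂ _*_ e₀ e₂ ⟩
    (N * p₀) * (N * p₂)   ≡⟨ interchange N p₀ N p₂ ⟩
    (N * N) * (p₀ * p₂)   ≤⟨ *-monoʳ-≤ (N * N) p≤ ⟩
    (N * N) * (p₁ * p₁)   ≡⟨ interchange N p₁ N p₁ ⟨
    (N * p₁) * (N * p₁)   ≡⟨ cong₂ _*_ e₁ e₁ ⟨
    (f₁ * D₁) * (f₁ * D₁) ≡⟨ interchange f₁ f₁ D₁ D₁ ⟨
    (f₁ * f₁) * (D₁ * D₁) ∎)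
  where open ≤-Reasoning

!-log-convex : ∀ n → (1 + n) ! * (1 + n) ! ≤ n ! * (2 + n) !
!-log-convex n = begin
  (suc n * n !) * (suc n * n !)       ≡⟨ solve 2 (λ k f → (k :* f) :* (k :* f) := f :* (k :* (k :* f))) refl (suc n) (n !) ⟩
  n ! * (suc n * (suc n * n !))       ≤⟨ *-monoʳ-≤ (n !) (*-monoˡ-≤ (suc n * n !) (n≤1+n (suc n))) ⟩
  n ! * (suc (suc n) * (suc n * n !)) ∎
  where open ≤-Reasoning

-- Log concavity is inherited by termwise products; `square-≥` is the same for log convexity.
square-≤ : ∀ a b c a′ b′ c′ → a * c ≤ b * b → a′ * c′ ≤ b′ * b′ → (a * a′) * (c * c′) ≤ (b * b′) * (b * b′)
square-≤ a b c a′ b′ c′ le le′ = begin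
  (a * a′) * (c * c′) ≡⟨ interchange a a′ c c′ ⟩
  (a * c) * (a′ * c′) ≤⟨ *-mono-≤ le le′ ⟩
  (b * b) * (b′ * b′) ≡⟨ interchange b b b′ b′ ⟩
  (b * b′) * (b * b′) ∎
  where open ≤-Reasoning

square-≥ : ∀ a b c a′ b′ c′ → b * b ≤ a * c → b′ * b′ ≤ a′ * c′ → (b * b′) * (b * b′) ≤ (a * a′) * (c * c′)
square-≥ a b c a′ b′ c′ le le′ = begin
  (b * b′) * (b * b′) ≡⟨ interchange b b′ b b′ ⟩
  (b * b) * (b′ * b′) ≤⟨ *-mono-≤ le le′ ⟩
  (a * c) * (a′ * c′) ≡⟨ interchange a c a′ c′ ⟩
  (a * a′) * (c * c′) ∎
  where open ≤-Reasoning

vandermonde-two-rows : ∀ t → ((1 + t) * (2 + t)) * ((2 + t) * (3 + t)) ≡ vandermonde 1 (1 + t) 1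
vandermonde-two-rows = solve 1 (λ t → ((con 1 :+ t) :* (con 2 :+ t)) :* ((con 2 :+ t) :* (con 3 :+ t)) :=
  con 1 :* (con 1 :+ t) :* con 1 :* (con 1 :+ (con 1 :+ t)) :* (con 1 :+ t :+ con 1) :* (con 1 :+ (con 1 :+ t) :+ con 1)) refl

-- All four nonconstant factors are linear, and each is log concave with step 2 because (t + 2)² - t
-- (t + 4) = 4. The auxiliary `g` collects two of them, so the whole is `g t * g (1 + t)`.
vandermonde-log-concave : ∀ t →
  vandermonde 1 (1 + t) 1 * vandermonde 1 (5 + t) 1 ≤ vandermonde 1 (3 + t) 1 * vandermonde 1 (3 + t) 1
vandermonde-log-concave t = subst₂ _≤_
  (cong₂ _*_ (vandermonde-two-rows t) (vandermonde-two-rows (4 + t)))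
  (cong₂ _*_ (vandermonde-two-rows (2 + t)) (vandermonde-two-rows (2 + t)))
  (square-≤ (g t) (g (2 + t)) (g (4 + t)) (g (1 + t)) (g (3 + t)) (g (5 + t)) (consecutive t) (consecutive (1 + t)))
  where
  g : ℕ → ℕ
  g t = (1 + t) * (2 + t)
  linear : ∀ t → t * (4 + t) ≤ (2 + t) * (2 + t)
  linear t = subst (t * (4 + t) ≤_)
    (solve 1 (λ t → t :* (con 4 :+ t) :+ con 4 := (con 2 :+ t) :* (con 2 :+ t)) refl t) (m≤m+n (t * (4 + t)) 4)
  consecutive : ∀ t → g t * g (4 + t) ≤ g (2 + t) * g (2 + t)
  consecutive t = square-≤ (1 + t) (3 + t) (5 + t) (2 + t) (4 + t) (6 + t) (linear (1 + t)) (linear (2 + t))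

hook-count : ∀ y j → count (2 * (y + j + j)) 0 y 0 j * ((3 + (y + j)) ! * (2 + (y + j)) ! * ((1 + j) ! * j !)) ≡
  (2 * (y + j + j)) ! * vandermonde 1 (1 + y) 1
hook-count y j = trans (cong (count (2 * (y + j + j)) 0 y 0 j *_) (sym (*-assoc ((3 + (y + j)) ! * (2 + (y + j)) !) ((1 + j) !) (j !))))
  (frobenius (2 * (y + j + j)) 0 y 0 j (size-two-rows y j))

-- The three shapes belong to k - 1, k, k + 1 for k = 3 + y + j. The factorials in k move up by one
-- each time, those in n - k down by one, and both kinds are log convex.
count-log-concave : ∀ y j {n} → n ≡ 2 + y + (1 + j) + (1 + j) →
  count (2 * n) 0 y 0 (2 + j) * count (2 * n) 0 (4 + y) 0 j ≤
  count (2 * n) 0 (2 + y) 0 (1 + j) * count (2 * n) 0 (2 + y) 0 (1 + j)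
count-log-concave y j {n} n≡ = log-concave-quotient {N = (2 * n) !}
  {count (2 * n) 0 y 0 (2 + j)} {count (2 * n) 0 (2 + y) 0 (1 + j)} {count (2 * n) 0 (4 + y) 0 j}
  {D (2 + z) (2 + j)} {D (3 + z) (1 + j)} {D (4 + z) j}
  {vandermonde 1 (1 + y) 1} {vandermonde 1 (3 + y) 1} {vandermonde 1 (5 + y) 1} {{hooks≢0}} e₀ e₁ e₂
  (square-≥ (upper (2 + z)) (upper (3 + z)) (upper (4 + z)) (lower (2 + j)) (lower (1 + j)) (lower j)
    (square-≥ ((5 + z) !) ((6 + z) !) ((7 + z) !) ((4 + z) !) ((5 + z) !) ((6 + z) !)
      (!-log-convex (5 + z)) (!-log-convex (4 + z)))
    (square-≥ ((3 + j) !) ((2 + j) !) ((1 + j) !) ((2 + j) !) ((1 + j) !) (j !)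
      (reversed (1 + j)) (reversed j)))
  (vandermonde-log-concave y)
  where
  z = y + j
  upper lower : ℕ → ℕ
  upper k = (3 + k) ! * (2 + k) !
  lower j = (1 + j) ! * j !
  D : ℕ → ℕ → ℕ
  D k j = upper k * lower j
  hooks≢0 : NonZero (D (3 + z) (1 + j))
  hooks≢0 = m*n≢0 (upper (3 + z)) (lower (1 + j))
    {{m*n≢0 ((6 + z) !) ((5 + z) !) {{(6 + z) !≢0}} {{(5 + z) !≢0}}}}
    {{m*n≢0 ((2 + j) !) ((1 + j) !) {{(2 + j) !≢0}} {{(1 + j) !≢0}}}}
  reversed : ∀ t → (1 + t) ! * (1 + t) ! ≤ (2 + t) ! * t !
  reversed t = subst ((1 + t) ! * (1 + t) ! ≤_) (*-comm (t !) ((2 + t) !)) (!-log-convex t)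
  at-size : ∀ y′ j′ k → y′ + j′ ≡ k → y′ + j′ + j′ ≡ n →
    count (2 * n) 0 y′ 0 j′ * D k j′ ≡ (2 * n) ! * vandermonde 1 (1 + y′) 1
  at-size y′ j′ _ refl refl = hook-count y′ j′
  e₀ = at-size y (2 + j) (2 + z) (solve 2 (λ y j → y :+ (con 2 :+ j) := con 2 :+ (y :+ j)) refl y j)
         (trans (solve 2 (λ y j → y :+ (con 2 :+ j) :+ (con 2 :+ j) := con 2 :+ y :+ (con 1 :+ j) :+ (con 1 :+ j)) refl y j) (sym n≡))
  e₁ = at-size (2 + y) (1 + j) (3 + z) (solve 2 (λ y j → con 2 :+ y :+ (con 1 :+ j) := con 3 :+ (y :+ j)) refl y j) (sym n≡)
  e₂ = at-size (4 + y) j (4 + z) refl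
         (trans (solve 2 (λ y j → con 4 :+ y :+ j :+ j := con 2 :+ y :+ (con 1 :+ j) :+ (con 1 :+ j)) refl y j) (sym n≡))

padded-inside : ∀ {n} l k → 1 ≤ k → k ≤ n → padded n l k ≡ l k
padded-inside {n} l (suc k) _ k<n with k <? n
... | yes _   = refl
... | no  k≮n = contradiction k<n k≮n

padded-zero : ∀ {n} l k → l k ≡ 0 → padded n l k ≡ 0
padded-zero     l zero    _ = refl
padded-zero {n} l (suc k) e with k <? n
... | yes _ = e
... | no  _ = refl

-- The sequence starts at k = ⌈ n / 2 ⌉, so only the instances k = 2 + y + (1 + j) with n - k = 1 + j have both neighbours
-- nonzero.

LogConcave-intro : ∀ {n} (l : ℕ → ℕ) → (∀ {k} → 2 * k < n → l k ≡ 0) →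
  (∀ y j → n ≡ 2 + y + (1 + j) + (1 + j) → l (y + (2 + j)) * l (4 + y + j) ≤ l (2 + y + (1 + j)) ^ 2) → LogConcave n l
LogConcave-intro {n} l small inner (suc k) 1≤1+k 1+k≤n with suc k <? n | n ≤? 2 * k
-- The centre is n and its right neighbour is padding.
... | no  _     | _        = subst (_≤ padded n l (suc k) ^ 2) (sym (*-zeroʳ (padded n l k))) z≤n
-- The left neighbour lies below n / 2; `k = 0` falls under this case.
... | yes _     | no n≰2k  = subst (λ p → p * l (2 + k) ≤ padded n l (suc k) ^ 2) (sym (padded-zero l k (small (≰⇒> n≰2k)))) z≤n
... | yes 2+k≤n | yes n≤2k = subst₂ (λ p q → p * l (2 + k) ≤ q ^ 2)
  (sym (padded-inside l k (≤-trans (s≤s z≤n) 2+j≤k) (<⇒≤ 1+k≤n))) (sym (padded-inside l (suc k) 1≤1+k 1+k≤n))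
  (subst₂ (λ a b → a * b ≤ l (suc k) ^ 2) (cong l k₀) (cong l k₂)
    (subst (λ b → l (y + (2 + j)) * l (4 + y + j) ≤ l b ^ 2) k₁ (inner y j n≡)))
  where
  -- With centre k + 1, these make 1 + j equal to n - (k + 1) and 2 + y equal to 2 (k + 1) - n. The
  -- second subtraction does not truncate, since n ≤ 2k gives 2 + j ≤ k.
  j = n ∸ (2 + k)
  y = k ∸ (2 + j)
  n≡2+k+j : n ≡ 2 + k + j
  n≡2+k+j = sym (m+[n∸m]≡n 2+k≤n)
  2+j≤k : 2 + j ≤ k
  2+j≤k = +-cancelˡ-≤ k _ _ (subst₂ _≤_ (trans n≡2+k+j (solve 2 (λ k j → con 2 :+ k :+ j := k :+ (con 2 :+ j)) refl k j))
    (cong (k +_) (+-identityʳ k)) n≤2k)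
  k₀ : y + (2 + j) ≡ k
  k₀ = m∸n+n≡m 2+j≤k
  k₁ : 2 + y + (1 + j) ≡ suc k
  k₁ = trans (solve 2 (λ y j → con 2 :+ y :+ (con 1 :+ j) := con 1 :+ (y :+ (con 2 :+ j))) refl y j) (cong suc k₀)
  k₂ : 4 + y + j ≡ 2 + k
  k₂ = trans (solve 2 (λ y j → con 4 :+ y :+ j := con 2 :+ (y :+ (con 2 :+ j))) refl y j) (cong (2 +_) k₀)
  n≡ : n ≡ 2 + y + (1 + j) + (1 + j)
  n≡ = trans n≡2+k+j (trans (solve 2 (λ k j → con 2 :+ k :+ j := con 1 :+ k :+ (con 1 :+ j)) refl k j) (cong (_+ (1 + j)) (sym k₁)))

theorem4p5 : (n : ℕ) → 1 ≤ n → LogConcave n (ℓ-d2row n) × LogConcave n (i-d2row n)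
theorem4p5 n 1≤n =
  LogConcave-intro (ℓ-d2row n) (ℓ-d2row-small 1≤n) ℓ-inner , LogConcave-intro (i-d2row n) (i-d2row-small 1≤n) i-inner
  where
  f : ℕ → ℕ → ℕ
  f y j = count (2 * n) 0 y 0 j
  f≤ : ∀ y j → n ≡ 2 + y + (1 + j) + (1 + j) → f y (2 + j) * f (4 + y) j ≤ f (2 + y) (1 + j) * f (2 + y) (1 + j)
  f≤ y j = count-log-concave y j
  self : ∀ a → a * a ≡ a ^ 2
  self a = cong (a *_) (sym (*-identityʳ a))
  left : ∀ y j → n ≡ 2 + y + (1 + j) + (1 + j) → n ≡ y + (2 + j) + (2 + j)
  left y j e = trans e (solve 2 (λ y j → con 2 :+ y :+ (con 1 :+ j) :+ (con 1 :+ j) := y :+ (con 2 :+ j) :+ (con 2 :+ j)) refl y j)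
  right′ : ∀ y j → n ≡ 2 + y + (1 + j) + (1 + j) → n ≡ 4 + y + j + j
  right′ y j e = trans e (solve 2 (λ y j → con 2 :+ y :+ (con 1 :+ j) :+ (con 1 :+ j) := con 4 :+ y :+ j :+ j) refl y j)
  positive : ∀ y j → 1 ≤ y + (2 + j)
  positive y j = ≤-trans (s≤s z≤n) (m≤n+m (2 + j) y)
  i-value : ∀ y j → 1 ≤ y + j → n ≡ y + j + j → i-d2row n (y + j) ≡ f y j
  i-value y j 1≤ refl = i-d2row-count y j 1≤
  ℓ-value : ∀ y j → 1 ≤ y + j → n ≡ y + j + j → ℓ-d2row n (y + j) ≡ f y j * f y j
  ℓ-value y j 1≤ refl = ℓ-d2row-count y j 1≤
  i-inner : ∀ y j → n ≡ 2 + y + (1 + j) + (1 + j) →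
    i-d2row n (y + (2 + j)) * i-d2row n (4 + y + j) ≤ i-d2row n (2 + y + (1 + j)) ^ 2
  i-inner y j e = subst₂ _≤_
    (sym (cong₂ _*_ (i-value y (2 + j) (positive y j) (left y j e)) (i-value (4 + y) j (s≤s z≤n) (right′ y j e))))
    (trans (self (f (2 + y) (1 + j))) (cong (_^ 2) (sym (i-value (2 + y) (1 + j) (s≤s z≤n) e)))) (f≤ y j e)
  ℓ-inner : ∀ y j → n ≡ 2 + y + (1 + j) + (1 + j) →
    ℓ-d2row n (y + (2 + j)) * ℓ-d2row n (4 + y + j) ≤ ℓ-d2row n (2 + y + (1 + j)) ^ 2
  ℓ-inner y j e = subst₂ _≤_
    (sym (cong₂ _*_ (ℓ-value y (2 + j) (positive y j) (left y j e)) (ℓ-value (4 + y) j (s≤s z≤n) (right′ y j e))))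
    (trans (self (f (2 + y) (1 + j) * f (2 + y) (1 + j))) (cong (_^ 2) (sym (ℓ-value (2 + y) (1 + j) (s≤s z≤n) e))))
    -- The terms are squares, so the inequality for involutions is multiplied by itself.
    (square-≤ f₀ f₁ f₂ f₀ f₁ f₂ (f≤ y j e) (f≤ y j e))
    where
    f₀ = f y (2 + j)
    f₁ = f (2 + y) (1 + j)
    f₂ = f (4 + y) j
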